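{- Let $k$ be a positive integer and let $G$ be a connected graph with $n$ vertices. Suppose that $G$ is not a $k$-clique (i.e. not isomorphic to $K_k$), and that it is not the case that $k=2$ and $G$ is a $5$-cycle. Then \[\iota(G,k) \leq \frac{n}{k+1}.\] Consequently, for any $k \geq 1$ and $n \geq 3$, \[\iota(n,k) = \iota(B_{n,k},k) = \left\lfloor \frac{n}{k+1} \right\rfloor.\]
   Context: All graphs are finite and simple. For a graph $G$ and $D \subseteq V(G)$, $N_G[D]$ denotes the closed neighbourhood $\bigcup_{v\in D}(\{v\}\cup N_G(v))$. A $k$-clique is a copy of the complete graph $K_k$. A set $D \subseteq V(G)$ is a $k$-clique isolating set of $G$ if the graph obtained from $G$ by deleting all vertices of $N_G[D]$ contains no $k$-clique; $\iota(G,k)$ denotes the minimum size of a $k$-clique isolating set of $G$. $P_m$ denotes the path with vertex set $[m]=\{1,\dots,m\}$ and edges $\{i,i+1\}$, $i\in[m-1]$; $C_5$ denotes the $5$-cycle. For $n,k\in\mathbb{N}$ with $k\neq 2$, $\iota(n,k)$ is the maximum of $\iota(G,k)$ over all connected graphs $G$ with vertex set $[n]$ that are not isomorphic to $K_k$. For $k=2$, $\iota(n,2)$ is the maximum of $\iota(G,2)$ over all connected graphs $G$ with vertex set $[n]$ that are isomorphic neither to $K_2$ nor to $C_5$. For $n,k\in\mathbb{N}$ let $a_{n,k}=\lfloor n/(k+1)\rfloor$ and $b_{n,k}=n-k\,a_{n,k}$ (so $a_{n,k}\le b_{n,k}\le a_{n,k}+k$). If $n\le k$, let $B_{n,k}=P_n$.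 If $n\ge k+1$, let $F_1,\dots,F_{a_{n,k}}$ be copies of $K_k$ such that $P_{b_{n,k}},F_1,\dots,F_{a_{n,k}}$ are pairwise vertex-disjoint, and let $B_{n,k}$ be the $n$-vertex graph obtained from $P_{b_{n,k}},F_1,\dots,F_{a_{n,k}}$ by joining, for each $i\in[a_{n,k}]$, the vertex $i$ of $P_{b_{n,k}}$ to every vertex of $F_i$. -}

module Defs where

open import Data.Nat using (ℕ; zero; suc; _+_; _*_; _∸_; _≤_; _<ᵇ_; _≡ᵇ_)
open import Data.Nat.DivMod using (_/_)
open import Data.Bool using (Bool; true; false; _∨_; _∧_; not; if_then_else_)
open import Data.Bool.Properties using (∨-comm)
open import Data.Fin using (Fin; toℕ; _≟_)
open import Data.Fin.Subset using (Subset; _∈_; ∣_∣)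
open import Data.Product using (Σ; _×_; _,_; ∃)
open import Data.Sum using (_⊎_)
open import Relation.Nullary using (¬_; does; yes; no)
open import Relation.Binary.PropositionalEquality using (_≡_; _≢_; refl; sym)
open import Function.Bundles using (_↔_; Inverse)
open import Function.Definitions using (Injective)

record Graph (n : ℕ) : Set where
  field
    adj   : Fin n → Fin n → Bool
    adj-sym : ∀ u v → adj u v ≡ adj v u
    adj-irrefl : ∀ u → adj u u ≡ false
open Graph public

symClose : ∀ {n} → (Fin n → Fin n → Bool) → Fin n → Fin n → Bool
symClose f u v = if does (u ≟ v) then false else (f u v ∨ f v u)

fromRel : ∀ {n} → (Fin n → Fin n → Bool) → Graph n
fromRel {n} f = record { adj = symClose f ; adj-sym = s ; adj-irrefl = i }
  where
  i : ∀ u → symClose f u u ≡ false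
  i u with u ≟ u
  ... | yes _ = refl
  ... | no u≢u with u≢u refl
  ...   | ()
  s : ∀ u v → symClose f u v ≡ symClose f v u
  s u v with u ≟ v | v ≟ u
  ... | yes _ | yes _ = refl
  ... | no _  | no _  = ∨-comm (f u v) (f v u)
  ... | yes p | no q with q (sym p)
  ...   | ()
  s u v | no q | yes p with q (sym p)
  ...   | ()

Iso : ∀ {n m} → Graph n → Graph m → Set
Iso {n} {m} G H =
  Σ (Fin n ↔ Fin m) λ φ →
    ∀ u v → adj G u v ≡ adj H (Inverse.to φ u) (Inverse.to φ v)

K : (k : ℕ) → Graph k
K k = fromRel (λ _ _ → true)

pathAdjℕ : ℕ → ℕ → Bool
pathAdjℕ i j = j ≡ᵇ suc i

-- path P_m (vertex i+1 of the paper is label i)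
P : (m : ℕ) → Graph m
P m = fromRel (λ u v → pathAdjℕ (toℕ u) (toℕ v))

C5 : Graph 5
C5 = fromRel (λ u v → pathAdjℕ (toℕ u) (toℕ v) ∨ ((toℕ u ≡ᵇ 4) ∧ (toℕ v ≡ᵇ 0)))

-- B_{n,k}.  a = ⌊n/(k+1)⌋, b = n - k a.  Labels 0..b-1 form the path
-- P_b (label p is path vertex p+1); for j < a, the labels
-- b + j k, …, b + (j+1) k - 1 form the clique F_{j+1}, all of whose
-- vertices are joined to path vertex j+1 (label j).
-- For k = 0 the cliques are empty and B_{n,0} = P_n.
-- For n ≤ k we get a = 0, b = n, i.e. B_{n,k} = P_n, as in the paper.
B-rel : (n k : ℕ) → Fin n → Fin n → Bool
B-rel n zero u v = pathAdjℕ (toℕ u) (toℕ v)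
B-rel n (suc k') u v =
  if x <ᵇ b then
    (if y <ᵇ b then pathAdjℕ x y else (x ≡ᵇ ((y ∸ b) / k)))
  else
    (if y <ᵇ b then (y ≡ᵇ ((x ∸ b) / k)) else (((x ∸ b) / k) ≡ᵇ ((y ∸ b) / k)))
  where
  k = suc k'
  a = n / suc k
  b = n ∸ k * a
  x = toℕ u
  y = toℕ v

B : (n k : ℕ) → Graph n
B n k = fromRel (B-rel n k)

data Reach {n} (G : Graph n) : Fin n → Fin n → Set where
  here : ∀ {u} → Reach G u u
  step : ∀ {u w v} → adj G u w ≡ true → Reach G w v → Reach G u v

Connected : ∀ {n} → Graph n → Set
Connected {n} G = ∀ (u v : Fin n) → Reach G u v

InClosedNbhd : ∀ {n} → Graph n → Subset n → Fin n → Set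
InClosedNbhd G D v = ∃ λ u → u ∈ D × (u ≡ v ⊎ adj G u v ≡ true)

CliqueAvoiding : ∀ {n} → Graph n → ℕ → Subset n → Set
CliqueAvoiding {n} G k D =
  Σ (Fin k → Fin n) λ f →
    Injective _≡_ _≡_ f
    × (∀ i j → i ≢ j → adj G (f i) (f j) ≡ true)
    × (∀ i → ¬ InClosedNbhd G D (f i))

IsolatingSet : ∀ {n} → Graph n → ℕ → Subset n → Set
IsolatingSet G k D = ¬ CliqueAvoiding G k D

IsIota : ∀ {n} → Graph n → ℕ → ℕ → Set
IsIota {n} G k m =
  (Σ (Subset n) λ D → IsolatingSet G k D × ∣ D ∣ ≡ m)
  × (∀ (D : Subset n) → IsolatingSet G k D → m ≤ ∣ D ∣)

Admissible : ∀ {n} → ℕ → Graph n → Set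
Admissible k G = Connected G × ¬ Iso G (K k) × (k ≡ 2 → ¬ Iso G C5)

IsIotaMax : ℕ → ℕ → ℕ → Set
IsIotaMax n k m =
  (Σ (Graph n) λ G → Admissible k G × IsIota G k m)
  × (∀ (G : Graph n) → Admissible k G → ∀ m' → IsIota G k m' → m' ≤ m)

{-# OPTIONS --safe #-}
module Submission where

-- Call a connected graph special if it is K_k, or C_5 with k = 2. By strong induction on the
-- vertex set S, every induced subgraph either has an isolating set of size ≤ |S|/(k+1) or has a
-- special component. For connected, non-special S with a k-clique, some v has |N[v]| ≥ k+1; take v,
-- and apply the hypothesis to S - N[v]. Only a special component H of S - N[v] is an obstruction.
-- * If H is linked to a single x ∈ N(v), then take x: every special component of S - x loses a
--   neighbour of x and stays within its budget, and the k that H saves pays for x.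
-- * Otherwise H is linked to distinct x, x′ ∈ N(v). A set that dominates x and H costs
--   at most (|H|+1)/(k+1), so the only obstruction is a special component C of S - x - H. It
--   contains v (else it is linked to x alone, as before), and likewise C′ for x′. If C is a
--   pentagon, v and x′ dominate all of it but one vertex, and H loses a neighbour of x′. If C
--   and C′ are both K_k, then S = {x} ∪ C ∪ H has 2k+1 vertices and maximum degree k; one vertex
--   isolates it unless S is itself a pentagon.
-- The bound is attained by B_{n,k} because each F_i with its path vertex must meet D.

open import Defs
open import Data.Bool using (Bool; true; false; T; if_then_else_)
import Data.Bool.Properties as Bool
open import Data.Empty using (⊥)
open import Data.Fin using (Fin; zero; suc; toℕ; fromℕ<; _≟_)
open import Data.Fin.Patterns using (0F; 1F; 2F; 3F; 4F)
open import Data.Fin.Properties using (any?; all?; toℕ<n; toℕ-fromℕ<; toℕ-injective)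
open import Data.Fin.Subset
  using (Subset; _∈_; _∉_; _⊆_; _∪_; _─_; _-_; ⁅_⁆; ∣_∣; Nonempty; ⊤; inside; outside)
  renaming (⊥ to ∅)
open import Data.Fin.Subset.Properties
open import Data.List using (List; []; _∷_; length; _++_; tabulate)
open import Data.List.Properties using (length-++; length-tabulate)
open import Data.List.Relation.Unary.All using (All; []; _∷_)
import Data.List.Relation.Unary.All as All
import Data.List.Relation.Unary.All.Properties as All
open import Data.List.Relation.Unary.AllPairs using ([]; _∷_)
open import Data.List.Relation.Unary.Any using (Any; here; there)
import Data.List.Relation.Unary.Any.Properties as Any
open import Data.List.Relation.Unary.Unique.Propositional using (Unique)
import Data.List.Relation.Unary.Unique.Propositional.Properties as Unique
open import Data.Nat
  using (ℕ; zero; suc; _+_; _*_; _∸_; _≤_; _<_; _/_; z≤n; s≤s; _≤?_; _<?_; _<ᵇ_; _≡ᵇ_; >-nonZero)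
import Data.Nat as ℕ
open import Data.Nat.DivMod
open import Data.Nat.Induction using (<-wellFounded)
open import Data.Nat.Solver using (module +-*-Solver)
open +-*-Solver using (solve; con; _:+_; _:=_)
open import Data.Nat.Properties hiding (_≟_; _≤?_; _<?_)
open import Data.Nat.Divisibility using (divides)
open import Data.Product using (Σ; _×_; _,_; proj₁; proj₂; ∃)
open import Data.Sum using (_⊎_; inj₁; inj₂; [_,_]′)
open import Data.Vec using ([]; _∷_; here; there)
import Data.Vec as Vec
import Data.Vec.Properties as Vec
open import Function using (_∘_; id)
open import Function.Definitions using (Injective)
open import Function.Bundles using (_↔_; Injection; Inverse; mk↔ₛ′)
open import Function.Properties.Inverse using (↔⇒↣)
open import Data.Fin.Permutation using (↔⇒≡)
open import Function.Construct.Identity using (↔-id)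
open import Induction.WellFounded using (Acc; acc)
open import Relation.Binary.PropositionalEquality
  using (_≡_; _≢_; refl; sym; trans; cong; cong₂; subst; subst₂; module ≡-Reasoning)
open import Relation.Nullary using (¬_; Dec; yes; no; does; contradiction)
open import Relation.Nullary.Decidable
  using (_×-dec_; _⊎-dec_; _→-dec_; ¬?; from-yes; dec-true; dec-false)

-- Finite subsets

x∈p─q⇒x∉q : ∀ {n} (p q : Subset n) {x} → x ∈ p ─ q → x ∉ q
x∈p─q⇒x∉q (_ ∷ p) (_ ∷ q) (there x∈) (there x∈q) = x∈p─q⇒x∉q p q x∈ x∈q
x∈p─q⇒x∉q (inside ∷ p) (inside ∷ q) () here
x∈p─q⇒x∉q (outside ∷ p) (inside ∷ q) () here

q⊆p⇒∣q∣+∣p─q∣≡∣p∣ : ∀ {n} {p q : Subset n} → q ⊆ p → ∣ q ∣ + ∣ p ─ q ∣ ≡ ∣ p ∣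
q⊆p⇒∣q∣+∣p─q∣≡∣p∣ {p = []} {[]} _ = refl
q⊆p⇒∣q∣+∣p─q∣≡∣p∣ {p = outside ∷ p} {outside ∷ q} q⊆p = q⊆p⇒∣q∣+∣p─q∣≡∣p∣ (drop-∷-⊆ q⊆p)
q⊆p⇒∣q∣+∣p─q∣≡∣p∣ {p = inside ∷ p} {outside ∷ q} q⊆p =
  trans (+-suc _ _) (cong suc (q⊆p⇒∣q∣+∣p─q∣≡∣p∣ (drop-∷-⊆ q⊆p)))
q⊆p⇒∣q∣+∣p─q∣≡∣p∣ {p = inside ∷ p} {inside ∷ q} q⊆p =
  cong suc (q⊆p⇒∣q∣+∣p─q∣≡∣p∣ (drop-∷-⊆ q⊆p))
q⊆p⇒∣q∣+∣p─q∣≡∣p∣ {p = outside ∷ p} {inside ∷ q} q⊆p with q⊆p here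
... | ()

module _ {n : ℕ} where

  disjoint⇒∣p∣+∣q∣≤∣r∣ : {p q r : Subset n} → p ⊆ r → q ⊆ r → (∀ {x} → x ∈ p → x ∉ q) →
                         ∣ p ∣ + ∣ q ∣ ≤ ∣ r ∣
  disjoint⇒∣p∣+∣q∣≤∣r∣ {p} {q} {r} p⊆r q⊆r disj = begin
    ∣ p ∣ + ∣ q ∣      ≤⟨ +-monoʳ-≤ ∣ p ∣ (p⊆q⇒∣p∣≤∣q∣ q⊆r─p) ⟩
    ∣ p ∣ + ∣ r ─ p ∣  ≡⟨ q⊆p⇒∣q∣+∣p─q∣≡∣p∣ p⊆r ⟩
    ∣ r ∣              ∎
    where
    open ≤-Reasoning
    q⊆r─p : q ⊆ r ─ p
    q⊆r─p x∈q = x∈p∧x∉q⇒x∈p─q (q⊆r x∈q) (λ x∈p → disj x∈p x∈q)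

  unique⇒length≤∣p∣ : {p : Subset n} (xs : List (Fin n)) → Unique xs → All (_∈ p) xs →
                      length xs ≤ ∣ p ∣
  unique⇒length≤∣p∣ [] _ _ = z≤n
  unique⇒length≤∣p∣ {p} (x ∷ xs) (x∉xs ∷ uniq) (x∈p ∷ xs⊆p) =
    ≤-trans (s≤s (unique⇒length≤∣p∣ xs uniq xs⊆p-x)) (x∈p⇒∣p-x∣<∣p∣ x∈p)
    where
    xs⊆p-x : All (_∈ p - x) xs
    xs⊆p-x = All.zipWith (λ (y∈p , x≢y) → x∈p∧x≢y⇒x∈p-y y∈p (x≢y ∘ sym)) (xs⊆p , x∉xs)

  injective⇒≤∣p∣ : ∀ {m} {p : Subset n} (f : Fin m → Fin n) → Injective _≡_ _≡_ f →
                   (∀ i → f i ∈ p) → m ≤ ∣ p ∣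
  injective⇒≤∣p∣ {m} {p} f inj f∈p =
    subst (_≤ ∣ p ∣) (length-tabulate f)
      (unique⇒length≤∣p∣ (tabulate f) (Unique.tabulate⁺ inj) (All.tabulate⁺ f∈p))

  ∃∈p∖q : {p q : Subset n} → ∣ q ∣ < ∣ p ∣ → ∃ λ x → x ∈ p × x ∉ q
  ∃∈p∖q {p} {q} q<p with any? (λ x → (x ∈? p) ×-dec ¬? (x ∈? q))
  ... | yes found = found
  ... | no none = contradiction (p⊆q⇒∣p∣≤∣q∣ p⊆q) (<⇒≱ q<p)
    where
    p⊆q : p ⊆ q
    p⊆q {x} x∈p with x ∈? q
    ... | yes x∈q = x∈q
    ... | no x∉q = contradiction (x , x∈p , x∉q) none

  1≤∣p∣⇒nonempty : {p : Subset n} → 1 ≤ ∣ p ∣ → Nonempty p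
  1≤∣p∣⇒nonempty {p} 1≤ with ∃∈p∖q {p} {∅} (subst (_< ∣ p ∣) (sym (∣⊥∣≡0 n)) 1≤)
  ... | x , x∈p , _ = x , x∈p

  comprehension : {P : Fin n → Set} → (∀ x → Dec (P x)) → Subset n
  comprehension P? = Vec.tabulate (λ x → does (P? x))

  module _ {P : Fin n → Set} (P? : ∀ x → Dec (P x)) where

    ∈comprehension⁺ : ∀ {x} → P x → x ∈ comprehension P?
    ∈comprehension⁺ {x} px =
      Vec.lookup⇒[]= x _ (trans (Vec.lookup∘tabulate _ x) (dec-true (P? x) px))

    ∈comprehension⁻ : ∀ {x} → x ∈ comprehension P? → P x
    ∈comprehension⁻ {x} x∈
      with P? x | trans (sym (Vec.lookup∘tabulate (λ y → does (P? y)) x)) (Vec.[]=⇒lookup x∈)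
    ... | yes px | _ = px
    ... | no _ | ()

  ∣p∪q∣≤∣p∣+∣q∣ : ∀ (p q : Subset n) → ∣ p ∪ q ∣ ≤ ∣ p ∣ + ∣ q ∣
  ∣p∪q∣≤∣p∣+∣q∣ p q = begin
    ∣ p ∪ q ∣                ≡⟨ q⊆p⇒∣q∣+∣p─q∣≡∣p∣ (p⊆p∪q {p = p} q) ⟨
    ∣ p ∣ + ∣ (p ∪ q) ─ p ∣  ≤⟨ +-monoʳ-≤ ∣ p ∣ (p⊆q⇒∣p∣≤∣q∣ p∪q─p⊆q) ⟩
    ∣ p ∣ + ∣ q ∣            ∎
    where
    open ≤-Reasoning
    p∪q─p⊆q : (p ∪ q) ─ p ⊆ q
    p∪q─p⊆q x∈ with x∈p∪q⁻ p q (p─q⊆p (p ∪ q) p x∈)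
    ... | inj₁ x∈p = contradiction x∈p (x∈p─q⇒x∉q (p ∪ q) p x∈)
    ... | inj₂ x∈q = x∈q

  fromList : List (Fin n) → Subset n
  fromList [] = ∅
  fromList (x ∷ xs) = ⁅ x ⁆ ∪ fromList xs

  ∣fromList∣≤length : ∀ xs → ∣ fromList xs ∣ ≤ length xs
  ∣fromList∣≤length [] = ≤-reflexive (∣⊥∣≡0 n)
  ∣fromList∣≤length (x ∷ xs) = begin
    ∣ ⁅ x ⁆ ∪ fromList xs ∣        ≤⟨ ∣p∪q∣≤∣p∣+∣q∣ ⁅ x ⁆ (fromList xs) ⟩
    ∣ ⁅ x ⁆ ∣ + ∣ fromList xs ∣    ≤⟨ +-mono-≤ (≤-reflexive (∣⁅x⁆∣≡1 x)) (∣fromList∣≤length xs) ⟩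
    suc (length xs)                ∎
    where open ≤-Reasoning

  Any⇒∃∈fromList : {P : Fin n → Set} {xs : List (Fin n)} → Any P xs → ∃ λ x → x ∈ fromList xs × P x
  Any⇒∃∈fromList {xs = x ∷ xs} (here px) = x , p⊆p∪q (fromList xs) (x∈⁅x⁆ x) , px
  Any⇒∃∈fromList {xs = x ∷ xs} (there pxs) =
    let y , y∈ , py = Any⇒∃∈fromList pxs in y , q⊆p∪q ⁅ x ⁆ (fromList xs) y∈ , py

-- The 5-cycle

private
  _≟ᵇ_ = Bool._≟_

-- The affine map of ℤ/5 sending 0 to i and 1 to j, as 4 = -1.
turn : Fin 5 → Fin 5 → Fin 5 → Fin 5
turn i j t = (toℕ i + toℕ t * (toℕ j + 4 * toℕ i)) mod 5

-- Decided by trying all cases. It allows any edge of a pentagon to be renumbered as the edge from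
-- corner 0 to corner 1.
turn-automorphism : ∀ i j → adj C5 i j ≡ true →
  (turn i j 0F ≡ i × turn i j 1F ≡ j)
  × (∀ s t → adj C5 (turn i j s) (turn i j t) ≡ adj C5 s t)
  × (∀ s → ∃ λ t → turn i j t ≡ s)
turn-automorphism = from-yes (all? λ i → all? λ j → (adj C5 i j ≟ᵇ true) →-dec
  (((turn i j 0F ≟ i) ×-dec (turn i j 1F ≟ j))
  ×-dec (all? λ s → all? λ t → adj C5 (turn i j s) (turn i j t) ≟ᵇ adj C5 s t)
  ×-dec (all? λ s → any? λ t → turn i j t ≟ s)))

C5-neighbour : ∀ i → ∃ λ j → adj C5 i j ≡ true
C5-neighbour = from-yes (all? λ i → any? λ j → adj C5 i j ≟ᵇ true)

-- Distinct corners have distinct neighbourhoods, so a map out of `C5` that preserves and reflects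
-- adjacency is automatically injective.
C5-twin-free : ∀ i j → (∀ t → adj C5 i t ≡ adj C5 j t) → i ≡ j
C5-twin-free = from-yes (all? λ i → all? λ j →
  (all? λ t → adj C5 i t ≟ᵇ adj C5 j t) →-dec (i ≟ j))

-- Isolation inside induced subgraphs

module Isolation {n : ℕ} (G : Graph n) (k : ℕ) (1≤k : 1 ≤ k) where

  infix 4 _~_ _~?_

  _~_ : Fin n → Fin n → Set
  u ~ v = adj G u v ≡ true

  _~?_ : ∀ u v → Dec (u ~ v)
  u ~? v = adj G u v ≟ᵇ true

  ~-sym : ∀ {u v} → u ~ v → v ~ u
  ~-sym {u} {v} = trans (adj-sym G v u)

  ~-irrefl : ∀ {u} → ¬ u ~ u
  ~-irrefl {u} u~u with trans (sym u~u) (adj-irrefl G u)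
  ... | ()

  ~⇒≢ : ∀ {u v} → u ~ v → u ≢ v
  ~⇒≢ u~v refl = ~-irrefl u~v

  ≁⇒false : ∀ {u v} → ¬ u ~ v → adj G u v ≡ false
  ≁⇒false {u} {v} u≁v with adj G u v
  ... | true = contradiction refl u≁v
  ... | false = refl

  Dominated : List (Fin n) → Fin n → Set
  Dominated D u = Any (λ w → w ≡ u ⊎ w ~ u) D

  IsClique : Subset n → Set
  IsClique U = ∀ u v → u ∈ U → v ∈ U → u ≢ v → u ~ v

  isClique? : ∀ U → Dec (IsClique U)
  isClique? U = all? λ u → all? λ v →
    (u ∈? U) →-dec (v ∈? U) →-dec ¬? (u ≟ v) →-dec (u ~? v)

  -- Cliques are vertex sets of at least k elements here, and the centres in D may lie outside S: a
  -- vertex chosen elsewhere can help to clear S.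
  Clear : List (Fin n) → Subset n → Set
  Clear D S = ∀ U → IsClique U → k ≤ ∣ U ∣ → U ⊆ S → (∀ {u} → u ∈ U → ¬ Dominated D u) → ⊥

  clear-mono : ∀ {D D′ S} → (∀ {u} → Dominated D u → Dominated D′ u) → Clear D S → Clear D′ S
  clear-mono D⇒D′ clear U cl k≤ U⊆S free = clear U cl k≤ U⊆S (λ u∈U → free u∈U ∘ D⇒D′)

  clear-small : ∀ {D S} → ∣ S ∣ < k → Clear D S
  clear-small S<k U _ k≤ U⊆S _ = <⇒≱ S<k (≤-trans k≤ (p⊆q⇒∣p∣≤∣q∣ U⊆S))

  -- A clique that avoids D lies in A ∪ B, and as no edge joins A to B, it lies wholly on the side
  -- of any one of its vertices. Such a vertex exists by `1≤k`.
  clear-split : ∀ {D S A B} → (∀ {u} → u ∈ S → Dominated D u ⊎ u ∈ A ⊎ u ∈ B) →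
                (∀ {a b} → a ∈ A → b ∈ B → ¬ a ~ b) → Clear D A → Clear D B → Clear D S
  clear-split {D} {S} {A} {B} cover sep clearA clearB U cl k≤ U⊆S free =
    meet (1≤∣p∣⇒nonempty (≤-trans 1≤k k≤))
    where
    inside-A : ∀ {u} → u ∈ U → u ∈ A → U ⊆ A
    inside-A {u} u∈U u∈A {w} w∈U with u ≟ w | cover (U⊆S w∈U)
    ... | yes refl | _ = u∈A
    ... | no _ | inj₁ dom = contradiction dom (free w∈U)
    ... | no _ | inj₂ (inj₁ w∈A) = w∈A
    ... | no u≢w | inj₂ (inj₂ w∈B) = contradiction (cl u w u∈U w∈U u≢w) (sep u∈A w∈B)

    inside-B : ∀ {u} → u ∈ U → u ∈ B → U ⊆ B
    inside-B {u} u∈U u∈B {w} w∈U with u ≟ w | cover (U⊆S w∈U)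
    ... | yes refl | _ = u∈B
    ... | no _ | inj₁ dom = contradiction dom (free w∈U)
    ... | no _ | inj₂ (inj₂ w∈B) = w∈B
    ... | no u≢w | inj₂ (inj₁ w∈A) = contradiction (cl w u w∈U u∈U (u≢w ∘ sym)) (sep w∈A u∈B)

    meet : Nonempty U → ⊥
    meet (u , u∈U) with cover (U⊆S u∈U)
    ... | inj₁ dom = free u∈U dom
    ... | inj₂ (inj₁ u∈A) = clearA U cl k≤ (inside-A u∈U u∈A) free
    ... | inj₂ (inj₂ u∈B) = clearB U cl k≤ (inside-B u∈U u∈B) free

  clear-undominated : ∀ {D S A} → (∀ {u} → u ∈ S → Dominated D u ⊎ u ∈ A) → Clear D A → Clear D S
  clear-undominated {D} {S} {A} cover clear U cl k≤ U⊆S free = clear U cl k≤ U⊆A free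
    where
    U⊆A : U ⊆ A
    U⊆A u∈U with cover (U⊆S u∈U)
    ... | inj₁ dom = contradiction dom (free u∈U)
    ... | inj₂ u∈A = u∈A

  -- The bound |S|/(k+1) is multiplied out, and centres form a list in which repetitions count, so
  -- that costs simply add under concatenation.
  record Good (S : Subset n) : Set where
    constructor good
    field
      centres : List (Fin n)
      cost    : length centres * suc k ≤ ∣ S ∣
      clear   : Clear centres S

  -- Components and connectedness

  Closed : Subset n → Subset n → Set
  Closed U S = ∀ u w → u ∈ U → w ∈ S → w ∉ U → ¬ u ~ w

  closed? : ∀ U S → Dec (Closed U S)
  closed? U S = all? λ u → all? λ w →
    (u ∈? U) →-dec (w ∈? S) →-dec ¬? (w ∈? U) →-dec ¬? (u ~? w)

  -- A union of connected components of the subgraph induced on S, possibly several or none.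
  record Component (U S : Subset n) : Set where
    constructor component
    field
      ⊆-whole : U ⊆ S
      closed  : Closed U S
  open Component

  component-refl : ∀ {S} → Component S S
  component-refl = component id (λ u w u∈ w∈ w∉ _ → w∉ w∈)

  component-trans : ∀ {H R S} → Component H R → Component R S → Component H S
  component-trans {H} {R} {S} cH cR = component (⊆-whole cR ∘ ⊆-whole cH) closed′
    where
    closed′ : Closed H S
    closed′ u w u∈H w∈S w∉H with w ∈? R
    ... | yes w∈R = closed cH u w u∈H w∈R w∉H
    ... | no w∉R = closed cR u w (⊆-whole cH u∈H) w∈S w∉R

  component-─ : ∀ {H R S} → Component H S → Component R S → Component (R ─ H) S
  component-─ {H} {R} {S} cH cR = component (⊆-whole cR ∘ p─q⊆p R H) closed′
    where
    closed′ : Closed (R ─ H) S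
    closed′ u w u∈ w∈S w∉ u~w with w ∈? R | w ∈? H
    ... | no w∉R | _ = closed cR u w (p─q⊆p R H u∈) w∈S w∉R u~w
    ... | yes w∈R | no w∉H = w∉ (x∈p∧x∉q⇒x∈p─q w∈R w∉H)
    ... | yes _ | yes w∈H =
      closed cH w u w∈H (⊆-whole cR (p─q⊆p R H u∈)) (x∈p─q⇒x∉q R H u∈) (~-sym u~w)

  -- Connectedness by cuts rather than by walks: this form can be decided by a search over subsets,
  -- and its failure hands over a `Split` for the recursion.
  Conn : Subset n → Set
  Conn S = ∀ U → Component U S → Nonempty U → S ⊆ U

  Split : Subset n → Set
  Split S = ∃ λ U → Component U S × Nonempty U × Nonempty (S ─ U)

  conn? : ∀ S → Conn S ⊎ Split S
  conn? S with anySubset? (λ U → (U ⊆? S) ×-dec closed? U S ×-dec nonempty? U ×-dec nonempty? (S ─ U))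
  ... | yes (U , U⊆S , cl , ne , ne′) = inj₂ (U , component U⊆S cl , ne , ne′)
  ... | no unsplit = inj₁ conn
    where
    conn : Conn S
    conn U cU ne {x} x∈S with x ∈? U
    ... | yes x∈U = x∈U
    ... | no x∉U = contradiction
      (U , (λ {w} → ⊆-whole cU {w}) , closed cU , ne , x , x∈p∧x∉q⇒x∈p─q x∈S x∉U) unsplit

  -- Without an edge to x, H would be closed in all of S although it misses x, against
  -- connectedness.
  touch : ∀ {S H x} → Conn S → x ∈ S → Component H (S - x) → Nonempty H → ∃ λ h → h ∈ H × x ~ h
  touch {S} {H} {x} conn x∈S cH ne with any? (λ h → (h ∈? H) ×-dec (x ~? h))
  ... | yes found = found
  ... | no none = contradiction (conn H (component H⊆S closed′) ne x∈S) x∉H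
    where
    H⊆S : H ⊆ S
    H⊆S = p─q⊆p S ⁅ x ⁆ ∘ ⊆-whole cH
    x∉H : x ∉ H
    x∉H x∈H = x∈p─q⇒x∉q S ⁅ x ⁆ (⊆-whole cH x∈H) (x∈⁅x⁆ x)
    closed′ : Closed H S
    closed′ u w u∈H w∈S w∉H u~w with w ≟ x
    ... | yes refl = none (u , u∈H , ~-sym u~w)
    ... | no w≢x = closed cH u w u∈H (x∈p∧x≢y⇒x∈p-y w∈S w≢x) w∉H u~w

  -- Pentagons and special vertex sets

  record Pentagon (H : Subset n) : Set where
    field
      corner      : Fin 5 → Fin n
      corner∈     : ∀ i → corner i ∈ H
      corner-onto : ∀ {u} → u ∈ H → ∃ λ i → corner i ≡ u
      corner-adj  : ∀ i j → adj G (corner i) (corner j) ≡ adj C5 i j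

    corner-injective : Injective _≡_ _≡_ corner
    corner-injective {i} {j} eq = C5-twin-free i j λ t →
      trans (sym (corner-adj i t)) (trans (cong (λ u → adj G u (corner t)) eq) (corner-adj j t))

    5≤∣H∣ : 5 ≤ ∣ H ∣
    5≤∣H∣ = injective⇒≤∣p∣ corner corner-injective corner∈
  open Pentagon

  pentagon-at : ∀ {H u w} → Pentagon H → u ∈ H → w ∈ H → u ~ w →
                Σ (Pentagon H) λ P → corner P 0F ≡ u × corner P 1F ≡ w
  pentagon-at {H} P u∈H w∈H u~w with corner-onto P u∈H | corner-onto P w∈H
  ... | i , refl | j , refl = turned , cong (corner P) at-0 , cong (corner P) at-1
    where
    facts = turn-automorphism i j (trans (sym (corner-adj P i j)) u~w)
    at-0 = proj₁ (proj₁ facts)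
    at-1 = proj₂ (proj₁ facts)
    onto : ∀ {u} → u ∈ H → ∃ λ t → corner P (turn i j t) ≡ u
    onto u∈H with corner-onto P u∈H
    ... | s , refl = let t , eq = proj₂ (proj₂ facts) s in t , cong (corner P) eq
    turned : Pentagon H
    turned = record
      { corner      = corner P ∘ turn i j
      ; corner∈     = corner∈ P ∘ turn i j
      ; corner-onto = onto
      ; corner-adj  = λ s t → trans (corner-adj P _ _) (proj₁ (proj₂ facts) s t)
      }

  pentagon-from : ∀ {H u} → Pentagon H → u ∈ H → Σ (Pentagon H) λ P → corner P 0F ≡ u
  pentagon-from P u∈H with corner-onto P u∈H
  ... | i , refl =
    let j , i~j = C5-neighbour i
        Q , at-0 , _ = pentagon-at P u∈H (corner∈ P j) (trans (corner-adj P i j) i~j)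
    in Q , at-0

  data Special (H : Subset n) : Set where
    clique   : IsClique H → ∣ H ∣ ≡ k → Special H
    pentagon : k ≡ 2 → Pentagon H → Special H

  special⇒1≤∣H∣ : ∀ {H} → Special H → 1 ≤ ∣ H ∣
  special⇒1≤∣H∣ (clique _ eq) = subst (1 ≤_) (sym eq) 1≤k
  special⇒1≤∣H∣ (pentagon _ P) = ≤-trans (s≤s z≤n) (5≤∣H∣ P)

  special⇒nonempty : ∀ {H} → Special H → Nonempty H
  special⇒nonempty = 1≤∣p∣⇒nonempty ∘ special⇒1≤∣H∣

  -- A k-clique with one dominated vertex has too few vertices left. In a pentagon, where `k ≡ 2`,
  -- put y at corner 0: corner 2 then dominates 1, 2 and 3, and the lone corner 4 holds no edge.
  -- Either way, k units of the budget |H| stay unspent.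
  special-finish : ∀ {H x y} → Special H → y ∈ H → x ~ y →
                   ∃ λ D → length D * suc k + k ≤ ∣ H ∣ × Clear (x ∷ D) H
  special-finish {H} {x} {y} (clique cl eq) y∈H x~y = [] , ≤-reflexive (sym eq) , clear
    where
    clear : Clear (x ∷ []) H
    clear U _ k≤ U⊆H free = <⇒≱ (p⊂q⇒∣p∣<∣q∣ {p = U} (U⊆H , y , y∈H , y∉U)) (subst (_≤ ∣ U ∣) (sym eq) k≤)
      where
      y∉U : y ∉ U
      y∉U y∈U = free y∈U (here (inj₂ x~y))
  special-finish {H} {x} (pentagon eq P₀) y∈H x~y with pentagon-from P₀ y∈H
  ... | P , refl = c 2F ∷ [] , cost eq (5≤∣H∣ P) , clear-undominated cover (clear-small small)
    where
    c = corner P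
    cost : ∀ {k h} → k ≡ 2 → 5 ≤ h → 1 * suc k + k ≤ h
    cost refl 5≤h = 5≤h
    small : ∣ ⁅ c 4F ⁆ ∣ < k
    small = ≤-reflexive (trans (cong suc (∣⁅x⁆∣≡1 (c 4F))) (sym eq))
    cover : ∀ {u} → u ∈ H → Dominated (x ∷ c 2F ∷ []) u ⊎ u ∈ ⁅ c 4F ⁆
    cover u∈H with corner-onto P u∈H
    ... | 0F , refl = inj₁ (here (inj₂ x~y))
    ... | 1F , refl = inj₁ (there (here (inj₂ (corner-adj P 2F 1F))))
    ... | 2F , refl = inj₁ (there (here (inj₁ refl)))
    ... | 3F , refl = inj₁ (there (here (inj₂ (corner-adj P 2F 3F))))
    ... | 4F , refl = inj₂ (x∈⁅x⁆ (c 4F))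

  -- The extra unit on the right is to be paid by a neighbour x of y outside H. A clique is
  -- dominated by y alone, at cost k + 1; a pentagon with y at corner 0 is dominated by corners 0
  -- and 2, at cost 6.
  special-dominate : ∀ {H y} → Special H → y ∈ H →
                     ∃ λ D → length D * suc k ≤ suc ∣ H ∣ ×
                       (∀ {x} → y ~ x → Dominated D x) × (∀ {h} → h ∈ H → Dominated D h)
  special-dominate {H} {y} (clique cl eq) y∈H =
    y ∷ [] , ≤-reflexive (trans (*-identityˡ (suc k)) (cong suc (sym eq))) , (λ y~x → here (inj₂ y~x)) , dom
    where
    dom : ∀ {h} → h ∈ H → Dominated (y ∷ []) h
    dom {h} h∈H with y ≟ h
    ... | yes y≡h = here (inj₁ y≡h)
    ... | no y≢h = here (inj₂ (cl y h y∈H h∈H y≢h))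
  special-dominate {H} (pentagon eq P₀) y∈H with pentagon-from P₀ y∈H
  ... | P , refl = c 0F ∷ c 2F ∷ [] , cost eq (5≤∣H∣ P) , (λ y~x → here (inj₂ y~x)) , dom
    where
    c = corner P
    cost : ∀ {k h} → k ≡ 2 → 5 ≤ h → 2 * suc k ≤ suc h
    cost refl 5≤h = s≤s 5≤h
    dom : ∀ {h} → h ∈ H → Dominated (c 0F ∷ c 2F ∷ []) h
    dom h∈H with corner-onto P h∈H
    ... | 0F , refl = here (inj₁ refl)
    ... | 1F , refl = here (inj₂ (corner-adj P 0F 1F))
    ... | 2F , refl = there (here (inj₁ refl))
    ... | 3F , refl = there (here (inj₂ (corner-adj P 2F 3F)))
    ... | 4F , refl = here (inj₂ (corner-adj P 0F 4F))

  Outcome : Subset n → Set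
  Outcome S = Good S ⊎ ∃ λ H → Component H S × Special H

  private
    ++-cost : ∀ {c} (D E : List (Fin n)) → length (D ++ E) * c ≡ length D * c + length E * c
    ++-cost {c} D E = trans (cong (_* c) (length-++ D)) (*-distribʳ-+ c (length D) (length E))

  ∈-⁻ : ∀ {S : Subset n} {x u} → u ∈ S - x → u ∈ S × u ≢ x
  ∈-⁻ {S} {x} u∈ = p─q⊆p S ⁅ x ⁆ u∈ , λ { refl → x∈p─q⇒x∉q S ⁅ x ⁆ u∈ (x∈⁅x⁆ x) }

  Rest : Subset n → Fin n → Subset n → Subset n
  Rest S x H = S ─ (⁅ x ⁆ ∪ H)

  ∈Rest⁺ : ∀ {S x H u} → u ∈ S → u ≢ x → u ∉ H → u ∈ Rest S x H
  ∈Rest⁺ {S} {x} {H} {u} u∈S u≢x u∉H = x∈p∧x∉q⇒x∈p─q u∈S λ u∈ →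
    [ u≢x ∘ x∈⁅y⁆⇒x≡y x , u∉H ]′ (x∈p∪q⁻ ⁅ x ⁆ H u∈)

  ∈Rest⁻ : ∀ {S x H u} → u ∈ Rest S x H → u ∈ S × u ≢ x × u ∉ H
  ∈Rest⁻ {S} {x} {H} {u} u∈ = p─q⊆p S (⁅ x ⁆ ∪ H) u∈
    , (λ { refl → u∉ (p⊆p∪q H (x∈⁅x⁆ x)) }) , u∉ ∘ q⊆p∪q ⁅ x ⁆ H
    where
    u∉ : u ∉ ⁅ x ⁆ ∪ H
    u∉ = x∈p─q⇒x∉q S (⁅ x ⁆ ∪ H) u∈

  ∣Rest∣ : ∀ {S x H} → x ∈ S → H ⊆ S → x ∉ H → suc (∣ H ∣ + ∣ Rest S x H ∣) ≤ ∣ S ∣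
  ∣Rest∣ {S} {x} {H} x∈S H⊆S x∉H = begin
    suc ∣ H ∣ + ∣ Rest S x H ∣          ≤⟨ +-monoˡ-≤ ∣ Rest S x H ∣ H<x∪H ⟩
    ∣ ⁅ x ⁆ ∪ H ∣ + ∣ Rest S x H ∣      ≡⟨ q⊆p⇒∣q∣+∣p─q∣≡∣p∣ x∪H⊆S ⟩
    ∣ S ∣                               ∎
    where
    open ≤-Reasoning
    H<x∪H : ∣ H ∣ < ∣ ⁅ x ⁆ ∪ H ∣
    H<x∪H = p⊂q⇒∣p∣<∣q∣ {p = H} (q⊆p∪q ⁅ x ⁆ H , x , p⊆p∪q H (x∈⁅x⁆ x) , x∉H)
    x∪H⊆S : ⁅ x ⁆ ∪ H ⊆ S
    x∪H⊆S u∈ with x∈p∪q⁻ ⁅ x ⁆ H u∈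
    ... | inj₁ u∈x = subst (_∈ S) (sym (x∈⁅y⁆⇒x≡y x u∈x)) x∈S
    ... | inj₂ u∈H = H⊆S u∈H

  InN : Subset n → Fin n → Fin n → Set
  InN S v u = u ∈ S × (u ≡ v ⊎ v ~ u)

  inN? : ∀ S v u → Dec (InN S v u)
  inN? S v u = (u ∈? S) ×-dec ((u ≟ v) ⊎-dec (v ~? u))

  N[_,_] : Subset n → Fin n → Subset n
  N[ S , v ] = comprehension (inN? S v)

  ∈N⁺ : ∀ {S v u} → InN S v u → u ∈ N[ S , v ]
  ∈N⁺ {S} {v} = ∈comprehension⁺ (inN? S v)

  ∈N⁻ : ∀ {S v u} → u ∈ N[ S , v ] → InN S v u
  ∈N⁻ {S} {v} = ∈comprehension⁻ (inN? S v)

  -- The induction step for a connected vertex set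

  module Induction (S : Subset n) (conn : Conn S)
                   (ih : ∀ R → ∣ R ∣ < ∣ S ∣ → Outcome R) where

    -- By connectedness x has a neighbour in every special component of R.
    absorb : ∀ {x} → x ∈ S → ∀ R → Acc _<_ ∣ R ∣ → Component R (S - x) →
             ∃ λ D → length D * suc k ≤ ∣ R ∣ × Clear (x ∷ D) R
    absorb {x} x∈S R (acc rec) cR
      with ih R (≤-<-trans (p⊆q⇒∣p∣≤∣q∣ (⊆-whole cR)) (x∈p⇒∣p-x∣<∣p∣ x∈S))
    ... | inj₁ (good D cost clear) = D , cost , clear-mono there clear
    ... | inj₂ (H , cH , sp)
      with touch conn x∈S (component-trans cH cR) (special⇒nonempty sp)
    ... | y , y∈H , x~y
      with special-finish sp y∈H x~y
         | absorb x∈S (R ─ H) (rec R─H<R) (component-─ (component-trans cH cR) cR)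
      where
      R─H<R : ∣ R ─ H ∣ < ∣ R ∣
      R─H<R = ≤-trans (+-monoˡ-≤ ∣ R ─ H ∣ (special⇒1≤∣H∣ sp))
                      (≤-reflexive (q⊆p⇒∣q∣+∣p─q∣≡∣p∣ (⊆-whole cH)))
    ... | D , costD , clearD | E , costE , clearE = D ++ E , cost , clear
      where
      cost : length (D ++ E) * suc k ≤ ∣ R ∣
      cost = begin
        length (D ++ E) * suc k              ≡⟨ ++-cost D E ⟩
        length D * suc k + length E * suc k  ≤⟨ +-mono-≤ (m+n≤o⇒m≤o _ costD) costE ⟩
        ∣ H ∣ + ∣ R ─ H ∣                    ≡⟨ q⊆p⇒∣q∣+∣p─q∣≡∣p∣ (⊆-whole cH) ⟩
        ∣ R ∣                                ∎
        where open ≤-Reasoning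
      cover : ∀ {u} → u ∈ R → Dominated (x ∷ D ++ E) u ⊎ u ∈ H ⊎ u ∈ R ─ H
      cover {u} u∈R with u ∈? H
      ... | yes u∈H = inj₂ (inj₁ u∈H)
      ... | no u∉H = inj₂ (inj₂ (x∈p∧x∉q⇒x∈p─q u∈R u∉H))
      clear : Clear (x ∷ D ++ E) R
      clear = clear-split cover
        (λ h∈H r∈ → closed cH _ _ h∈H (p─q⊆p R H r∈) (x∈p─q⇒x∉q R H r∈))
        (clear-mono Any.++⁺ˡ clearD)
        (clear-mono (λ { (here d) → here d ; (there d) → there (Any.++⁺ʳ D d) }) clearE)

    -- Taking x costs k + 1, paid by x itself and the k units that `special-finish` saves on H. With
    -- the help of x, `absorb` clears the rest of S - x within its own budget.
    cut-vertex : ∀ {x H} → x ∈ S → Component H (S - x) → Special H → Good S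
    cut-vertex {x} {H} x∈S cH sp
      with touch conn x∈S cH (special⇒nonempty sp)
    ... | y , y∈H , x~y
      with special-finish sp y∈H x~y
         | absorb x∈S (Rest S x H) (<-wellFounded _) cRest
      where
      cRest : Component (Rest S x H) (S - x)
      cRest = component
        (λ u∈ → let u∈S , u≢x , _ = ∈Rest⁻ u∈ in x∈p∧x≢y⇒x∈p-y u∈S u≢x)
        closed′
        where
        closed′ : Closed (Rest S x H) (S - x)
        closed′ u w u∈ w∈ w∉ u~w with w ∈? H
        ... | no w∉H = let w∈S , w≢x = ∈-⁻ {S} w∈ in w∉ (∈Rest⁺ w∈S w≢x w∉H)
        ... | yes w∈H = let u∈S , u≢x , u∉H = ∈Rest⁻ u∈ in
          closed cH w u w∈H (x∈p∧x≢y⇒x∈p-y u∈S u≢x) u∉H (~-sym u~w)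
    ... | D , costD , clearD | E , costE , clearE = good (x ∷ D ++ E) cost clear
      where
      cost : suc k + length (D ++ E) * suc k ≤ ∣ S ∣
      cost = begin
        suc (k + length (D ++ E) * suc k)              ≡⟨ cong (λ m → suc (k + m)) (++-cost D E) ⟩
        suc (k + (length D * suc k + length E * suc k)) ≡⟨ cong suc (+-assoc k _ _) ⟨
        suc (k + length D * suc k + length E * suc k)  ≡⟨ cong (λ m → suc (m + length E * suc k)) (+-comm k _) ⟩
        suc (length D * suc k + k + length E * suc k)  ≤⟨ s≤s (+-mono-≤ costD costE) ⟩
        suc (∣ H ∣ + ∣ Rest S x H ∣)                   ≤⟨ ∣Rest∣ x∈S (proj₁ ∘ ∈-⁻ {S} ∘ ⊆-whole cH)
                                                             (λ x∈H → proj₂ (∈-⁻ {S} (⊆-whole cH x∈H)) refl) ⟩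
        ∣ S ∣                                          ∎
        where open ≤-Reasoning
      cover : ∀ {u} → u ∈ S → Dominated (x ∷ D ++ E) u ⊎ u ∈ H ⊎ u ∈ Rest S x H
      cover {u} u∈S with x ≟ u | u ∈? H
      ... | yes x≡u | _ = inj₁ (here (inj₁ x≡u))
      ... | no _ | yes u∈H = inj₂ (inj₁ u∈H)
      ... | no x≢u | no u∉H = inj₂ (inj₂ (∈Rest⁺ u∈S (x≢u ∘ sym) u∉H))
      clear : Clear (x ∷ D ++ E) S
      clear = clear-split cover
        (λ h∈H r∈ → let r∈S , r≢x , r∉H = ∈Rest⁻ {S} {x} {H} r∈ in
          closed cH _ _ h∈H (x∈p∧x≢y⇒x∈p-y r∈S r≢x) r∉H)
        (clear-mono Any.++⁺ˡ clearD)
        (clear-mono (λ { (here d) → here d ; (there d) → there (Any.++⁺ʳ D d) }) clearE)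

    -- Removing the closed neighbourhood of a vertex

    module At {v : Fin n} (v∈S : v ∈ S) (big : suc k ≤ ∣ N[ S , v ] ∣) where

      Nᵥ : Subset n
      Nᵥ = N[ S , v ]

      Nᵥ⊆S : Nᵥ ⊆ S
      Nᵥ⊆S = proj₁ ∘ ∈N⁻ {S}

      v∈Nᵥ : v ∈ Nᵥ
      v∈Nᵥ = ∈N⁺ (v∈S , inj₁ refl)

      module Away {H : Subset n} (cH : Component H (S ─ Nᵥ)) (sp : Special H) where

        H⊆S : H ⊆ S
        H⊆S = p─q⊆p S Nᵥ ∘ ⊆-whole cH

        H∩N : ∀ {h} → h ∈ H → ¬ v ~ h
        H∩N h∈H v~h = x∈p─q⇒x∉q S Nᵥ (⊆-whole cH h∈H) (∈N⁺ (H⊆S h∈H , inj₂ v~h))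

        v∉H : v ∉ H
        v∉H v∈H = x∈p─q⇒x∉q S Nᵥ (⊆-whole cH v∈H) v∈Nᵥ

        -- As H is closed in `S ─ Nᵥ`, an edge leaving it ends in `Nᵥ`, and not at v, which has no
        -- neighbour in H.
        exit-H : ∀ {h w} → h ∈ H → w ∈ S → w ∉ H → h ~ w → v ~ w
        exit-H {h} {w} h∈H w∈S w∉H h~w with w ∈? Nᵥ
        ... | no w∉N = contradiction h~w (closed cH h w h∈H (x∈p∧x∉q⇒x∈p─q w∈S w∉N) w∉H)
        ... | yes w∈N with ∈N⁻ {S} w∈N
        ...   | _ , inj₁ refl = contradiction (~-sym h~w) (H∩N h∈H)
        ...   | _ , inj₂ v~w = v~w

        record Link (x y : Fin n) : Set where
          field
            x∈S : x ∈ S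
            v~x : v ~ x
            y∈H : y ∈ H
            x~y : x ~ y

          x∉H : x ∉ H
          x∉H x∈H = H∩N x∈H v~x
        open Link

        -- C is the side of v in S - x - H. By `N⊆C` it takes in every neighbour of v in S other
        -- than x.
        record Across (x : Fin n) (C : Subset n) : Set where
          field
            comp : Component C (Rest S x H)
            v∈C  : v ∈ C

          C⊆S : C ⊆ S
          C⊆S u∈C = proj₁ (∈Rest⁻ {S} {x} {H} (⊆-whole comp u∈C))

          x∉C : x ∉ C
          x∉C x∈C = proj₁ (proj₂ (∈Rest⁻ {S} {x} {H} (⊆-whole comp x∈C))) refl

          C∩H : ∀ {u} → u ∈ C → u ∉ H
          C∩H u∈C = proj₂ (proj₂ (∈Rest⁻ {S} {x} {H} (⊆-whole comp u∈C)))

          enter-C : ∀ {c w} → c ∈ C → w ∈ S → w ≢ x → w ∉ H → c ~ w → w ∈ C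
          enter-C {c} {w} c∈C w∈S w≢x w∉H c~w with w ∈? C
          ... | yes w∈C = w∈C
          ... | no w∉C = contradiction c~w (closed comp c w c∈C (∈Rest⁺ w∈S w≢x w∉H) w∉C)

          N⊆C : ∀ {w} → w ∈ S → v ~ w → w ≢ x → w ∈ C
          N⊆C w∈S v~w w≢x = enter-C v∈C w∈S w≢x (λ w∈H → H∩N w∈H v~w) v~w
        open Across

        -- If the rest is good, dominating H together with x costs at most |H| + 1, which H and x
        -- pay. If the rest has a special component C without v, then C has no edge to H, so only x
        -- links it to the remainder of S and `cut-vertex` applies.
        across : ∀ {x y} → Link x y → Good S ⊎ ∃ λ C → Across x C × Special C
        across {x} {y} l with ih (Rest S x H) (≤-trans (s≤s (m≤n+m _ ∣ H ∣)) (∣Rest∣ (x∈S l) H⊆S (x∉H l)))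
        ... | inj₁ (good D cost clear)
          with special-dominate sp (y∈H l)
        ... | E , costE , dom-y , dom-H = inj₁ (good (E ++ D) cost′ clear′)
          where
          cost′ : length (E ++ D) * suc k ≤ ∣ S ∣
          cost′ = begin
            length (E ++ D) * suc k              ≡⟨ ++-cost E D ⟩
            length E * suc k + length D * suc k  ≤⟨ +-mono-≤ costE cost ⟩
            suc ∣ H ∣ + ∣ Rest S x H ∣           ≤⟨ ∣Rest∣ (x∈S l) H⊆S (x∉H l) ⟩
            ∣ S ∣                                ∎
            where open ≤-Reasoning
          cover : ∀ {u} → u ∈ S → Dominated (E ++ D) u ⊎ u ∈ Rest S x H
          cover {u} u∈S with u ≟ x | u ∈? H
          ... | yes refl | _ = inj₁ (Any.++⁺ˡ (dom-y (~-sym (x~y l))))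
          ... | no _ | yes u∈H = inj₁ (Any.++⁺ˡ (dom-H u∈H))
          ... | no u≢x | no u∉H = inj₂ (∈Rest⁺ u∈S u≢x u∉H)
          clear′ : Clear (E ++ D) S
          clear′ = clear-undominated cover (clear-mono (Any.++⁺ʳ E) clear)
        across {x} {y} l | inj₂ (C , cC , spC) with v ∈? C
        ... | yes v∈C = inj₂ (C , record { comp = cC ; v∈C = v∈C } , spC)
        ... | no v∉C = inj₁ (cut-vertex (x∈S l) (component C⊆S-x closed′) spC)
          where
          C⊆S-x : C ⊆ S - x
          C⊆S-x u∈C = let u∈S , u≢x , _ = ∈Rest⁻ {S} {x} {H} (⊆-whole cC u∈C) in x∈p∧x≢y⇒x∈p-y u∈S u≢x
          closed′ : Closed C (S - x)
          closed′ u w u∈C w∈ w∉C u~w with ∈-⁻ {S} w∈ | ∈Rest⁻ {S} {x} {H} (⊆-whole cC u∈C) | w ∈? H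
          ... | w∈S , w≢x | _ | no w∉H = closed cC u w u∈C (∈Rest⁺ w∈S w≢x w∉H) w∉C u~w
          -- An edge from C to H would make u a neighbour of v, and so put v into C.
          ... | _ | u∈S , _ , u∉H | yes w∈H = closed cC u v u∈C
            (∈Rest⁺ v∈S (~⇒≢ (v~x l)) v∉H) v∉C
            (~-sym (exit-H w∈H u∈S u∉H (~-sym u~w)))

        -- With corner 0 at v and corner 1 at x′, these two centres dominate x and every corner but
        -- 3, and x′ gives H a dominated vertex. A special component of what remains after x, H and
        -- C could only be linked to x, since any other outside neighbour of H or C already belongs
        -- to C.
        two-sided-pentagon : ∀ {x y x′ y′ C} → Link x y → Link x′ y′ → x′ ≢ x →
                             Across x C → k ≡ 2 → Pentagon C → Good S
        two-sided-pentagon {x} {y} {x′} {y′} {C} l l′ x′≢x ac eq P₀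
          with pentagon-at P₀ (v∈C ac) (N⊆C ac (x∈S l′) (v~x l′) x′≢x) (v~x l′)
        ... | P , refl , refl
          with ih (Rest S x (H ∪ C)) (≤-trans (s≤s (m≤n+m _ ∣ H ∪ C ∣)) size)
          where
          size : suc (∣ H ∪ C ∣ + ∣ Rest S x (H ∪ C) ∣) ≤ ∣ S ∣
          size = ∣Rest∣ (x∈S l) (λ u∈ → [ H⊆S , C⊆S ac ]′ (x∈p∪q⁻ H C u∈))
            (λ x∈ → [ x∉H l , x∉C ac ]′ (x∈p∪q⁻ H C x∈))
        ... | inj₂ (E , cE , spE) = cut-vertex (x∈S l) (component E⊆S-x closed′) spE
          where
          R⁻ : ∀ {u} → u ∈ Rest S x (H ∪ C) → u ∈ S × u ≢ x × u ∉ H ∪ C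
          R⁻ = ∈Rest⁻ {S} {x} {H ∪ C}
          E⊆S-x : E ⊆ S - x
          E⊆S-x u∈E = let u∈S , u≢x , _ = R⁻ (⊆-whole cE u∈E) in x∈p∧x≢y⇒x∈p-y u∈S u≢x
          closed′ : Closed E (S - x)
          closed′ u w u∈E w∈ w∉E u~w with ∈-⁻ {S} w∈ | R⁻ (⊆-whole cE u∈E) | w ∈? H | w ∈? C
          ... | _ | u∈S , u≢x , u∉ | yes w∈H | _ = u∉ (q⊆p∪q H C
            (N⊆C ac u∈S (exit-H w∈H u∈S (u∉ ∘ p⊆p∪q C) (~-sym u~w)) u≢x))
          ... | _ | u∈S , u≢x , u∉ | no _ | yes w∈C = u∉ (q⊆p∪q H C
            (enter-C ac w∈C u∈S u≢x (u∉ ∘ p⊆p∪q C) (~-sym u~w)))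
          ... | w∈S , w≢x | _ | no w∉H | no w∉C = closed cE u w u∈E
            (∈Rest⁺ w∈S w≢x (λ w∈ → [ w∉H , w∉C ]′ (x∈p∪q⁻ H C w∈))) w∉E u~w
        ... | inj₁ (good D costD clearD)
          with special-finish sp (y∈H l′) (x~y l′)
        ... | E , costE , clearE = good (c 0F ∷ c 1F ∷ E ++ D) cost clear
          where
          c = corner P
          R = Rest S x (H ∪ C)
          R⁻ : ∀ {u} → u ∈ R → u ∈ S × u ≢ x × u ∉ H ∪ C
          R⁻ = ∈Rest⁻ {S} {x} {H ∪ C}
          arithmetic : ∀ {k e d h r s} → k ≡ 2 → e * suc k + k ≤ h → d * suc k ≤ r →
                       suc (h + 5 + r) ≤ s → suc k + (suc k + (e * suc k + d * suc k)) ≤ s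
          -- The 6 units for v and x′ come from x (1), the saving on H (2), and 3 of the 5 corners.
          arithmetic {e = e} {d} {h} {r} {s} refl e≤ d≤ s≥ = begin
            6 + (e * 3 + d * 3)      ≡⟨ solve 2 (λ a b → con 6 :+ (a :+ b) := con 1 :+ (a :+ con 2 :+ con 3 :+ b))
                                              refl (e * 3) (d * 3) ⟩
            suc (e * 3 + 2 + 3 + d * 3)  ≤⟨ s≤s (+-mono-≤ (+-mono-≤ e≤ (s≤s (s≤s (s≤s (z≤n {2}))))) d≤) ⟩
            suc (h + 5 + r)          ≤⟨ s≥ ⟩
            s                        ∎
            where open ≤-Reasoning
          size : suc (∣ H ∣ + 5 + ∣ R ∣) ≤ ∣ S ∣
          size = begin
            suc (∣ H ∣ + 5 + ∣ R ∣)      ≤⟨ s≤s (+-monoˡ-≤ ∣ R ∣ H+5≤) ⟩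
            suc (∣ H ∪ C ∣ + ∣ R ∣)      ≤⟨ ∣Rest∣ (x∈S l) (λ u∈ → [ H⊆S , C⊆S ac ]′ (x∈p∪q⁻ H C u∈))
                                              (λ x∈ → [ x∉H l , x∉C ac ]′ (x∈p∪q⁻ H C x∈)) ⟩
            ∣ S ∣                        ∎
            where
            open ≤-Reasoning
            H+5≤ : ∣ H ∣ + 5 ≤ ∣ H ∪ C ∣
            H+5≤ = ≤-trans (+-monoʳ-≤ ∣ H ∣ (5≤∣H∣ P))
              (disjoint⇒∣p∣+∣q∣≤∣r∣ (p⊆p∪q C) (q⊆p∪q H C) (λ u∈H u∈C → C∩H ac u∈C u∈H))
          cost : length (c 0F ∷ c 1F ∷ E ++ D) * suc k ≤ ∣ S ∣
          cost = subst (λ m → suc k + (suc k + m) ≤ ∣ S ∣) (sym (++-cost E D))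
            (arithmetic {e = length E} {length D} eq costE costD size)
          B′ = ⁅ c 3F ⁆ ∪ R
          cover : ∀ {u} → u ∈ S → Dominated (c 0F ∷ c 1F ∷ E ++ D) u ⊎ u ∈ H ⊎ u ∈ B′
          cover {u} u∈S with u ≟ x | u ∈? H | u ∈? C
          ... | yes refl | _ | _ = inj₁ (here (inj₂ (v~x l)))
          ... | no _ | yes u∈H | _ = inj₂ (inj₁ u∈H)
          ... | no u≢x | no u∉H | no u∉C = inj₂ (inj₂ (q⊆p∪q ⁅ c 3F ⁆ R
            (∈Rest⁺ u∈S u≢x (λ u∈ → [ u∉H , u∉C ]′ (x∈p∪q⁻ H C u∈)))))
          ... | no _ | no _ | yes u∈C with corner-onto P u∈C
          ...   | 0F , refl = inj₁ (here (inj₁ refl))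
          ...   | 1F , refl = inj₁ (there (here (inj₁ refl)))
          ...   | 2F , refl = inj₁ (there (here (inj₂ (corner-adj P 1F 2F))))
          ...   | 3F , refl = inj₂ (inj₂ (p⊆p∪q R (x∈⁅x⁆ (c 3F))))
          ...   | 4F , refl = inj₁ (here (inj₂ (corner-adj P 0F 4F)))
          -- Corner 3 is not adjacent to v, so `exit-H` keeps it apart from H. It has no edge into R
          -- either, and a single vertex is too small for a clique when `k ≡ 2`.
          v≁c3 : ¬ v ~ c 3F
          v≁c3 v~c3 with trans (sym v~c3) (corner-adj P 0F 3F)
          ... | ()
          sep : ∀ {a b} → a ∈ H → b ∈ B′ → ¬ a ~ b
          sep {a} {b} a∈H b∈ a~b with x∈p∪q⁻ ⁅ c 3F ⁆ R b∈
          ... | inj₁ b∈c3 with x∈⁅y⁆⇒x≡y (c 3F) b∈c3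
          ...   | refl = v≁c3 (exit-H a∈H (C⊆S ac (corner∈ P 3F)) (C∩H ac (corner∈ P 3F)) a~b)
          sep {a} {b} a∈H b∈ a~b | inj₂ b∈R =
            let b∈S , b≢x , b∉ = R⁻ b∈R in
            b∉ (q⊆p∪q H C (N⊆C ac b∈S (exit-H a∈H b∈S (b∉ ∘ p⊆p∪q C) a~b) b≢x))
          sep′ : ∀ {a b} → a ∈ ⁅ c 3F ⁆ → b ∈ R → ¬ a ~ b
          sep′ a∈ b∈R a~b with x∈⁅y⁆⇒x≡y (c 3F) a∈
          ... | refl = let b∈S , b≢x , b∉ = R⁻ b∈R in
            b∉ (q⊆p∪q H C (enter-C ac (corner∈ P 3F) b∈S b≢x (b∉ ∘ p⊆p∪q C) a~b))
          small : ∣ ⁅ c 3F ⁆ ∣ < k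
          small = ≤-reflexive (trans (cong suc (∣⁅x⁆∣≡1 (c 3F))) (sym eq))
          clear : Clear (c 0F ∷ c 1F ∷ E ++ D) S
          clear = clear-split cover sep
            (clear-mono (λ { (here d) → there (here d) ; (there d) → there (there (Any.++⁺ˡ d)) }) clearE)
            (clear-split (λ u∈ → inj₂ (x∈p∪q⁻ ⁅ c 3F ⁆ R u∈)) sep′ (clear-small small)
              (clear-mono (λ d → there (there (Any.++⁺ʳ E d))) clearD))

        -- Cliques on both sides under a degree bound

        module TwoCliques (bound : ∀ {u} → u ∈ S → ∣ N[ S , u ] ∣ ≤ suc k)
                          {x y x′ y′ : Fin n} (l : Link x y) (l′ : Link x′ y′) (x′≢x : x′ ≢ x)
                          {C C′ : Subset n} (ac : Across x C) (ac′ : Across x′ C′)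
                          (clC : IsClique C) (∣C∣ : ∣ C ∣ ≡ k) (clC′ : IsClique C′) where

          x′∈C : x′ ∈ C
          x′∈C = N⊆C ac (x∈S l′) (v~x l′) x′≢x

          x∈C′ : x ∈ C′
          x∈C′ = N⊆C ac′ (x∈S l) (v~x l) (x′≢x ∘ sym)

          C⊆N : ∀ {u} → u ∈ C → u ≡ v ⊎ v ~ u
          C⊆N {u} u∈C with u ≟ v
          ... | yes u≡v = inj₁ u≡v
          ... | no u≢v = inj₂ (clC v u (v∈C ac) u∈C (u≢v ∘ sym))

          -- The set {x} ∪ C ∪ H is closed in S, hence is all of S. Edges leaving H end at
          -- neighbours of v, and edges leaving C end at x or in H. A neighbour of x outside the set
          -- would lie in C′; as C′ is a clique containing v, it would be a neighbour of v and so
          -- lie in C after all.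
          S-cover : ∀ {u} → u ∈ S → u ≡ x ⊎ u ∈ C ⊎ u ∈ H
          S-cover {u} u∈S with x∈p∪q⁻ ⁅ x ⁆ (C ∪ H) (conn W (component W⊆S closed′) (v , v∈W) u∈S)
            where
            W = ⁅ x ⁆ ∪ (C ∪ H)
            C⊆W : C ⊆ W
            C⊆W = q⊆p∪q ⁅ x ⁆ (C ∪ H) ∘ p⊆p∪q H
            v∈W : v ∈ W
            v∈W = C⊆W (v∈C ac)
            W⊆S : W ⊆ S
            W⊆S w∈ with x∈p∪q⁻ ⁅ x ⁆ (C ∪ H) w∈
            ... | inj₁ w∈x = subst (_∈ S) (sym (x∈⁅y⁆⇒x≡y x w∈x)) (x∈S l)
            ... | inj₂ w∈C∪H = [ C⊆S ac , H⊆S ]′ (x∈p∪q⁻ C H w∈C∪H)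
            N⊆W : ∀ {w} → w ∈ S → v ~ w → w ∈ W
            N⊆W {w} w∈S v~w with w ≟ x
            ... | yes refl = p⊆p∪q (C ∪ H) (x∈⁅x⁆ x)
            ... | no w≢x = C⊆W (N⊆C ac w∈S v~w w≢x)
            closed′ : Closed W S
            closed′ u w u∈W w∈S w∉W u~w with x∈p∪q⁻ ⁅ x ⁆ (C ∪ H) u∈W
            ... | inj₂ u∈C∪H with x∈p∪q⁻ C H u∈C∪H
            ...   | inj₂ u∈H = w∉W (N⊆W w∈S (exit-H u∈H w∈S (w∉W ∘ q⊆p∪q ⁅ x ⁆ (C ∪ H) ∘ q⊆p∪q C H) u~w))
            ...   | inj₁ u∈C = w∉W (C⊆W (enter-C ac u∈C w∈S
                    (λ { refl → w∉W (p⊆p∪q (C ∪ H) (x∈⁅x⁆ x)) })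
                    (w∉W ∘ q⊆p∪q ⁅ x ⁆ (C ∪ H) ∘ q⊆p∪q C H) u~w))
            closed′ u w u∈W w∈S w∉W u~w | inj₁ u∈x with x∈⁅y⁆⇒x≡y x u∈x
            ... | refl = w∉W (N⊆W w∈S (clC′ v w (v∈C ac′) w∈C′ (λ { refl → w∉W v∈W })))
              where
              w∈C′ : w ∈ C′
              w∈C′ = enter-C ac′ x∈C′ w∈S (λ { refl → w∉W (C⊆W x′∈C) })
                (w∉W ∘ q⊆p∪q ⁅ x ⁆ (C ∪ H) ∘ q⊆p∪q C H) u~w
          ... | inj₁ u∈x = inj₁ (x∈⁅y⁆⇒x≡y x u∈x)
          ... | inj₂ u∈C∪H = inj₂ (x∈p∪q⁻ C H u∈C∪H)

          -- The closed neighbourhood of u would contain T, a and b: k + 2 vertices, against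
          -- `bound`.
          overfull : ∀ {T u a b} → IsClique T → ∣ T ∣ ≡ k → T ⊆ S → u ∈ T → a ∈ S → b ∈ S →
                     a ∉ T → b ∉ T → a ≢ b → u ~ a → ¬ u ~ b
          overfull {T} {u} {a} {b} clT ∣T∣ T⊆S u∈T a∈S b∈S a∉T b∉T a≢b u~a u~b =
            <⇒≱ (≤-reflexive (+-comm 2 k)) (begin
              k + 2                        ≤⟨ +-mono-≤ (≤-reflexive (sym ∣T∣)) two ⟩
              ∣ T ∣ + ∣ N[ S , u ] ─ T ∣   ≡⟨ q⊆p⇒∣q∣+∣p─q∣≡∣p∣ T⊆N ⟩
              ∣ N[ S , u ] ∣               ≤⟨ bound (T⊆S u∈T) ⟩
              suc k                        ∎)
            where
            open ≤-Reasoning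
            T⊆N : T ⊆ N[ S , u ]
            T⊆N {w} w∈T with w ≟ u
            ... | yes w≡u = ∈N⁺ (T⊆S w∈T , inj₁ w≡u)
            ... | no w≢u = ∈N⁺ (T⊆S w∈T , inj₂ (clT u w u∈T w∈T (w≢u ∘ sym)))
            two : 2 ≤ ∣ N[ S , u ] ─ T ∣
            two = unique⇒length≤∣p∣ (a ∷ b ∷ []) ((a≢b ∷ []) ∷ [] ∷ [])
              (x∈p∧x∉q⇒x∈p─q (∈N⁺ (a∈S , inj₂ u~a)) a∉T ∷ x∈p∧x∉q⇒x∈p─q (∈N⁺ (b∈S , inj₂ u~b)) b∉T ∷ [])

          -- The corner y, its two neighbouring corners and x make four vertices of one closed
          -- neighbourhood, where only 3 are allowed.
          H-not-pentagon : k ≡ 2 → ¬ Pentagon H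
          H-not-pentagon eq P₀ with pentagon-from P₀ (y∈H l)
          ... | P , refl = <⇒≱ (subst (λ m → suc m < 4) (sym eq) ≤-refl)
            (≤-trans four (bound (H⊆S (y∈H l))))
            where
            c = corner P
            c≢ : ∀ {i j} → i ≢ j → c i ≢ c j
            c≢ i≢j = i≢j ∘ corner-injective P
            c≢x : ∀ {i} → c i ≢ x
            c≢x refl = x∉H l (corner∈ P _)
            four : 4 ≤ ∣ N[ S , c 0F ] ∣
            four = unique⇒length≤∣p∣ (c 0F ∷ c 1F ∷ c 4F ∷ x ∷ [])
              ((c≢ (λ ()) ∷ c≢ (λ ()) ∷ c≢x ∷ []) ∷ (c≢ (λ ()) ∷ c≢x ∷ []) ∷ (c≢x ∷ []) ∷ [] ∷ [])
              ( ∈N⁺ (H⊆S (corner∈ P 0F) , inj₁ refl)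
              ∷ ∈N⁺ (H⊆S (corner∈ P 1F) , inj₂ (corner-adj P 0F 1F))
              ∷ ∈N⁺ (H⊆S (corner∈ P 4F) , inj₂ (corner-adj P 0F 4F))
              ∷ ∈N⁺ (x∈S l , inj₂ (~-sym (x~y l))) ∷ [])

          module _ (clH : IsClique H) (∣H∣ : ∣ H ∣ ≡ k) where

            y≢y′ : y ≢ y′
            y≢y′ refl = overfull clH ∣H∣ H⊆S (y∈H l) (x∈S l) (x∈S l′) (x∉H l) (x∉H l′)
              (x′≢x ∘ sym) (~-sym (x~y l)) (~-sym (x~y l′))

            -- Through the clique C′, x dominates all of C but x′; it also dominates y. An
            -- undominated clique thus consists of vertices of H - y and possibly x′. Without x′ it
            -- has at most k - 1 vertices. With x′ it misses h too, because by `overfull` y′ is the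
            -- only neighbour of x′ in H, and again at most k - 1 vertices remain.
            x-centre : ∀ {h} → h ∈ H → h ≢ y → h ≢ y′ → Good S
            x-centre {h} h∈H h≢y h≢y′ = good (x ∷ []) cost clear
              where
              cost : 1 * suc k ≤ ∣ S ∣
              cost = ≤-trans (≤-reflexive (*-identityˡ (suc k))) (≤-trans big (p⊆q⇒∣p∣≤∣q∣ Nᵥ⊆S))
              x′≁h : ¬ x′ ~ h
              x′≁h = overfull clC ∣C∣ (C⊆S ac) x′∈C (H⊆S (y∈H l′)) (H⊆S h∈H)
                (λ y′∈C → C∩H ac y′∈C (y∈H l′)) (λ h∈C → C∩H ac h∈C h∈H) (h≢y′ ∘ sym) (x~y l′)
              undominated : ∀ {u} → u ∈ S → ¬ Dominated (x ∷ []) u → u ≡ x′ ⊎ u ∈ H - y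
              undominated {u} u∈S free with S-cover u∈S
              ... | inj₁ refl = contradiction (here (inj₁ refl)) free
              ... | inj₂ (inj₂ u∈H) = inj₂ (x∈p∧x≢y⇒x∈p-y u∈H (λ { refl → free (here (inj₂ (x~y l))) }))
              ... | inj₂ (inj₁ u∈C) with u ≟ x′ | C⊆N u∈C
              ...   | yes u≡x′ | _ = inj₁ u≡x′
              ...   | no _ | inj₁ refl = contradiction (here (inj₂ (~-sym (v~x l)))) free
              ...   | no u≢x′ | inj₂ v~u = contradiction
                (here (inj₂ (clC′ x u x∈C′ (N⊆C ac′ u∈S v~u u≢x′) λ { refl → x∉C ac u∈C }))) free
              clear : Clear (x ∷ []) S
              clear U clU k≤ U⊆S free with x′ ∈? U
              ... | no x′∉U = <⇒≱ (x∈p⇒∣p-x∣<∣p∣ (y∈H l))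
                (≤-trans (≤-reflexive ∣H∣) (≤-trans k≤ (p⊆q⇒∣p∣≤∣q∣ U⊆H-y)))
                where
                U⊆H-y : U ⊆ H - y
                U⊆H-y u∈U with undominated (U⊆S u∈U) (free u∈U)
                ... | inj₁ refl = contradiction u∈U x′∉U
                ... | inj₂ u∈ = u∈
              ... | yes x′∈U = <⇒≱ (≤-trans (s≤s h-removed) (x∈p⇒∣p-x∣<∣p∣ (y∈H l))) (begin
                ∣ H ∣                       ≡⟨ ∣H∣ ⟩
                k                           ≤⟨ k≤ ⟩
                ∣ U ∣                       ≡⟨ q⊆p⇒∣q∣+∣p─q∣≡∣p∣ {p = U} x′⊆U ⟨
                ∣ ⁅ x′ ⁆ ∣ + ∣ U - x′ ∣     ≡⟨ cong (_+ ∣ U - x′ ∣) (∣⁅x⁆∣≡1 x′) ⟩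
                suc ∣ U - x′ ∣              ≤⟨ s≤s (p⊆q⇒∣p∣≤∣q∣ U-x′⊆) ⟩
                suc ∣ H - y - h ∣           ∎)
                where
                open ≤-Reasoning
                h-removed : ∣ H - y - h ∣ < ∣ H - y ∣
                h-removed = x∈p⇒∣p-x∣<∣p∣ (x∈p∧x≢y⇒x∈p-y h∈H h≢y)
                x′⊆U : ⁅ x′ ⁆ ⊆ U
                x′⊆U u∈ = subst (_∈ U) (sym (x∈⁅y⁆⇒x≡y x′ u∈)) x′∈U
                U-x′⊆ : U - x′ ⊆ H - y - h
                U-x′⊆ u∈ with ∈-⁻ {U} u∈
                ... | u∈U , u≢x′ with undominated (U⊆S u∈U) (free u∈U)
                ...   | inj₁ u≡x′ = contradiction u≡x′ u≢x′
                ...   | inj₂ u∈H-y = x∈p∧x≢y⇒x∈p-y u∈H-y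
                  λ { refl → x′≁h (clU _ _ x′∈U u∈U (u≢x′ ∘ sym)) }

            module _ (H⊆yy′ : ∀ {h} → h ∈ H → h ≡ y ⊎ h ≡ y′) where

              k≡2 : k ≡ 2
              k≡2 = ≤-antisym k≤2 2≤k
                where
                k≤2 : k ≤ 2
                k≤2 = begin
                  k                                      ≡⟨ ∣H∣ ⟨
                  ∣ H ∣                                  ≤⟨ p⊆q⇒∣p∣≤∣q∣ H⊆ ⟩
                  ∣ fromList (y ∷ y′ ∷ []) ∣             ≤⟨ ∣fromList∣≤length (y ∷ y′ ∷ []) ⟩
                  2                                      ∎
                  where
                  open ≤-Reasoning
                  H⊆ : H ⊆ fromList (y ∷ y′ ∷ [])
                  H⊆ h∈H with H⊆yy′ h∈H
                  ... | inj₁ refl = p⊆p∪q _ (x∈⁅x⁆ y)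
                  ... | inj₂ refl = q⊆p∪q ⁅ y ⁆ _ (p⊆p∪q ∅ (x∈⁅x⁆ y′))
                2≤k : 2 ≤ k
                2≤k = subst (2 ≤_) ∣C∣ (unique⇒length≤∣p∣ (v ∷ x′ ∷ [])
                  ((~⇒≢ (v~x l′) ∷ []) ∷ [] ∷ []) (v∈C ac ∷ x′∈C ∷ []))

              C⊆vx′ : ∀ {u} → u ∈ C → u ≡ v ⊎ u ≡ x′
              C⊆vx′ {u} u∈C with u ≟ v | u ≟ x′
              ... | yes u≡v | _ = inj₁ u≡v
              ... | no _ | yes u≡x′ = inj₂ u≡x′
              ... | no u≢v | no u≢x′ = contradiction
                (unique⇒length≤∣p∣ (u ∷ v ∷ x′ ∷ [])
                  ((u≢v ∷ u≢x′ ∷ []) ∷ (~⇒≢ (v~x l′) ∷ []) ∷ [] ∷ []) (u∈C ∷ v∈C ac ∷ x′∈C ∷ []))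
                (<⇒≱ (≤-reflexive (cong suc (trans ∣C∣ k≡2))))

              -- Closed neighbourhoods have at most 3 vertices when `k ≡ 2`, so two neighbours of u
              -- exclude a third.
              no-chord : ∀ {u a b c} → u ∈ S → a ∈ S → b ∈ S → c ∈ S → a ≢ b → a ≢ c → b ≢ c →
                         u ~ a → u ~ b → adj G u c ≡ false
              no-chord {u} {a} {b} {c} u∈S a∈S b∈S c∈S a≢b a≢c b≢c u~a u~b = ≁⇒false λ u~c →
                <⇒≱ (subst (λ m → suc m < 4) (sym k≡2) ≤-refl) (≤-trans
                  (unique⇒length≤∣p∣ (u ∷ a ∷ b ∷ c ∷ [])
                    ((~⇒≢ u~a ∷ ~⇒≢ u~b ∷ ~⇒≢ u~c ∷ []) ∷ (a≢b ∷ a≢c ∷ []) ∷ (b≢c ∷ []) ∷ [] ∷ [])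
                    (∈N⁺ (u∈S , inj₁ refl) ∷ ∈N⁺ (a∈S , inj₂ u~a) ∷
                     ∈N⁺ (b∈S , inj₂ u~b) ∷ ∈N⁺ (c∈S , inj₂ u~c) ∷ []))
                  (bound u∈S))

              -- The cycle is v, x, y, y′, x′. Its non-edges at v hold because v has no neighbour in
              -- H; the others hold because x and x′ already have two neighbours each.
              S-pentagon : Pentagon S
              S-pentagon = record
                { corner = c ; corner∈ = c∈ ; corner-onto = onto ; corner-adj = c-adj }
                where
                c : Fin 5 → Fin n
                c 0F = v
                c 1F = x
                c 2F = y
                c 3F = y′
                c 4F = x′
                c∈ : ∀ i → c i ∈ S
                c∈ 0F = v∈S
                c∈ 1F = x∈S l
                c∈ 2F = H⊆S (y∈H l)
                c∈ 3F = H⊆S (y∈H l′)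
                c∈ 4F = x∈S l′
                onto : ∀ {u} → u ∈ S → ∃ λ i → c i ≡ u
                onto u∈S with S-cover u∈S
                ... | inj₁ refl = 1F , refl
                ... | inj₂ (inj₁ u∈C) = [ (λ { refl → 0F , refl }) , (λ { refl → 4F , refl }) ]′ (C⊆vx′ u∈C)
                ... | inj₂ (inj₂ u∈H) = [ (λ { refl → 2F , refl }) , (λ { refl → 3F , refl }) ]′ (H⊆yy′ u∈H)
                flip : ∀ {u w b} → adj G u w ≡ b → adj G w u ≡ b
                flip {u} {w} = trans (adj-sym G w u)
                v≢H : ∀ {h} → h ∈ H → v ≢ h
                v≢H h∈H refl = v∉H h∈H
                e12 = x~y l
                e34 = ~-sym (x~y l′)
                e23 = clH y y′ (y∈H l) (y∈H l′) y≢y′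
                n02 = ≁⇒false (H∩N (y∈H l))
                n03 = ≁⇒false (H∩N (y∈H l′))
                n13 = no-chord (x∈S l) v∈S (c∈ 2F) (c∈ 3F) (v≢H (y∈H l)) (v≢H (y∈H l′)) y≢y′
                  (~-sym (v~x l)) e12
                n14 = no-chord (x∈S l) v∈S (c∈ 2F) (c∈ 4F) (v≢H (y∈H l)) (~⇒≢ (v~x l′))
                  (λ { refl → x∉H l′ (y∈H l) }) (~-sym (v~x l)) e12
                n42 = no-chord (x∈S l′) v∈S (c∈ 3F) (c∈ 2F) (v≢H (y∈H l′)) (v≢H (y∈H l)) (y≢y′ ∘ sym)
                  (~-sym (v~x l′)) (x~y l′)
                c-adj : ∀ i j → adj G (c i) (c j) ≡ adj C5 i j
                c-adj 0F 0F = adj-irrefl G v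
                c-adj 0F 1F = v~x l
                c-adj 0F 2F = n02
                c-adj 0F 3F = n03
                c-adj 0F 4F = v~x l′
                c-adj 1F 0F = flip (v~x l)
                c-adj 1F 1F = adj-irrefl G x
                c-adj 1F 2F = e12
                c-adj 1F 3F = n13
                c-adj 1F 4F = n14
                c-adj 2F 0F = flip n02
                c-adj 2F 1F = flip e12
                c-adj 2F 2F = adj-irrefl G y
                c-adj 2F 3F = e23
                c-adj 2F 4F = flip n42
                c-adj 3F 0F = flip n03
                c-adj 3F 1F = flip n13
                c-adj 3F 2F = flip e23
                c-adj 3F 3F = adj-irrefl G y′
                c-adj 3F 4F = e34
                c-adj 4F 0F = flip (v~x l′)
                c-adj 4F 1F = flip n14
                c-adj 4F 2F = n42
                c-adj 4F 3F = flip e34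
                c-adj 4F 4F = adj-irrefl G x′

          two-cliques : Special H → Outcome S
          two-cliques (pentagon eq P) = contradiction P (H-not-pentagon eq)
          two-cliques (clique clH ∣H∣) with any? (λ h → (h ∈? H) ×-dec ¬? (h ≟ y) ×-dec ¬? (h ≟ y′))
          ... | yes (h , h∈H , h≢y , h≢y′) = inj₁ (x-centre clH ∣H∣ h∈H h≢y h≢y′)
          ... | no none = inj₂ (S , component-refl ,
            pentagon (k≡2 clH ∣H∣ H⊆yy′) (S-pentagon clH ∣H∣ H⊆yy′))
            where
            H⊆yy′ : ∀ {h} → h ∈ H → h ≡ y ⊎ h ≡ y′
            H⊆yy′ {h} h∈H with h ≟ y | h ≟ y′
            ... | yes h≡y | _ = inj₁ h≡y
            ... | no _ | yes h≡y′ = inj₂ h≡y′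
            ... | no h≢y | no h≢y′ = contradiction (h , h∈H , h≢y , h≢y′) none

        first-link : ∃ λ x → ∃ λ y → Link x y
        first-link with any? (λ x → any? λ y → (x ∈? S) ×-dec ¬? (x ∈? H) ×-dec (y ∈? H) ×-dec (x ~? y))
        ... | yes (x , y , x∈S , x∉H , y∈H , x~y) = x , y , record
          { x∈S = x∈S ; v~x = exit-H y∈H x∈S x∉H (~-sym x~y) ; y∈H = y∈H ; x~y = x~y }
        ... | no none = contradiction (conn H (component H⊆S closed′) (special⇒nonempty sp) v∈S) v∉H
          where
          closed′ : Closed H S
          closed′ u w u∈H w∈S w∉H u~w = none (w , u , w∈S , w∉H , u∈H , ~-sym u~w)

        -- If every edge leaving H ended at x, then H would be closed in S - x and `cut-vertex`
        -- would finish.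
        second-link : ∀ {x y} → Link x y → Good S ⊎ ∃ λ x′ → ∃ λ y′ → Link x′ y′ × x′ ≢ x
        second-link {x} l with any? (λ x′ → any? λ y′ →
          (x′ ∈? S) ×-dec (v ~? x′) ×-dec (y′ ∈? H) ×-dec (x′ ~? y′) ×-dec ¬? (x′ ≟ x))
        ... | yes (x′ , y′ , x′∈S , v~x′ , y′∈H , x′~y′ , x′≢x) = inj₂ (x′ , y′ , record
          { x∈S = x′∈S ; v~x = v~x′ ; y∈H = y′∈H ; x~y = x′~y′ } , x′≢x)
        ... | no none = inj₁ (cut-vertex (x∈S l) (component H⊆S-x closed′) sp)
          where
          H⊆S-x : H ⊆ S - x
          H⊆S-x h∈H = x∈p∧x≢y⇒x∈p-y (H⊆S h∈H) (λ { refl → x∉H l h∈H })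
          closed′ : Closed H (S - x)
          closed′ u w u∈H w∈ w∉H u~w = let w∈S , w≢x = ∈-⁻ {S} w∈ in
            none (w , u , w∈S , exit-H u∈H w∈S w∉H u~w , u∈H , ~-sym u~w , w≢x)

        module _ (Δ : 2 + k ≤ ∣ Nᵥ ∣ ⊎ (∀ {u} → u ∈ S → ∣ N[ S , u ] ∣ ≤ suc k)) where

          -- `Nᵥ` lies in {x} ∪ C, which has at most k + 1 vertices; this rules out the first
          -- alternative of `Δ`.
          clique-bound : ∀ {x C} → Across x C → ∣ C ∣ ≡ k → ∀ {u} → u ∈ S → ∣ N[ S , u ] ∣ ≤ suc k
          clique-bound {x} {C} ac ∣C∣ u∈S =
            [ (λ 2+k≤ → contradiction ∣N∣≤ (<⇒≱ 2+k≤)) , (λ bound → bound u∈S) ]′ Δ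
            where
            N⊆ : Nᵥ ⊆ ⁅ x ⁆ ∪ C
            N⊆ {w} w∈N with w ≟ x | ∈N⁻ {S} w∈N
            ... | yes refl | _ = p⊆p∪q C (x∈⁅x⁆ x)
            ... | no _ | _ , inj₁ refl = q⊆p∪q ⁅ x ⁆ C (v∈C ac)
            ... | no w≢x | w∈S , inj₂ v~w = q⊆p∪q ⁅ x ⁆ C (N⊆C ac w∈S v~w w≢x)
            ∣N∣≤ : ∣ Nᵥ ∣ ≤ suc k
            ∣N∣≤ = begin
              ∣ Nᵥ ∣               ≤⟨ p⊆q⇒∣p∣≤∣q∣ N⊆ ⟩
              ∣ ⁅ x ⁆ ∪ C ∣        ≤⟨ ∣p∪q∣≤∣p∣+∣q∣ ⁅ x ⁆ C ⟩
              ∣ ⁅ x ⁆ ∣ + ∣ C ∣    ≡⟨ cong₂ _+_ (∣⁅x⁆∣≡1 x) ∣C∣ ⟩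
              suc k                ∎
              where open ≤-Reasoning

          special-outcome : Outcome S
          special-outcome with first-link
          ... | x , y , l with second-link l
          ... | inj₁ done = inj₁ done
          ... | inj₂ (x′ , y′ , l′ , x′≢x) with across l | across l′
          ... | inj₁ done | _ = inj₁ done
          ... | _ | inj₁ done = inj₁ done
          ... | inj₂ (C , ac , pentagon eq P) | _ = inj₁ (two-sided-pentagon l l′ x′≢x ac eq P)
          ... | _ | inj₂ (C′ , ac′ , pentagon eq P) =
            inj₁ (two-sided-pentagon l′ l (x′≢x ∘ sym) ac′ eq P)
          ... | inj₂ (C , ac , clique clC ∣C∣) | inj₂ (C′ , ac′ , clique clC′ _) =
            TwoCliques.two-cliques (clique-bound ac ∣C∣) l l′ x′≢x ac ac′ clC ∣C∣ clC′ sp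

      vertex-outcome : 2 + k ≤ ∣ Nᵥ ∣ ⊎ (∀ {u} → u ∈ S → ∣ N[ S , u ] ∣ ≤ suc k) → Outcome S
      vertex-outcome Δ with ih (S ─ Nᵥ) (p∩q≢∅⇒∣p─q∣<∣p∣ S Nᵥ (v , x∈p∩q⁺ (v∈S , v∈Nᵥ)))
      ... | inj₂ (H , cH , sp) = Away.special-outcome cH sp Δ
      ... | inj₁ (good D cost clear) = inj₁ (good (v ∷ D) cost′ clear′)
        where
        cost′ : suc k + length D * suc k ≤ ∣ S ∣
        cost′ = ≤-trans (+-mono-≤ big cost) (≤-reflexive (q⊆p⇒∣q∣+∣p─q∣≡∣p∣ Nᵥ⊆S))
        cover : ∀ {u} → u ∈ S → Dominated (v ∷ D) u ⊎ u ∈ S ─ Nᵥ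
        cover {u} u∈S with u ∈? Nᵥ
        ... | no u∉N = inj₂ (x∈p∧x∉q⇒x∈p─q u∈S u∉N)
        ... | yes u∈N = inj₁ (here ([ inj₁ ∘ sym , inj₂ ]′ (proj₂ (∈N⁻ {S} u∈N))))
        clear′ : Clear (v ∷ D) S
        clear′ = clear-undominated cover (clear-mono there clear)

    -- A k-clique fills the closed neighbourhood of each of its vertices, so no edge leaves it and
    -- it is itself a special component.
    low-degree-outcome : (∀ {u} → u ∈ S → ∣ N[ S , u ] ∣ ≤ k) → Outcome S
    low-degree-outcome bound
      with anySubset? (λ U → isClique? U ×-dec (k ≤? ∣ U ∣) ×-dec (U ⊆? S))
    ... | no none = inj₁ (good [] z≤n λ U cl k≤ U⊆S _ → none (U , cl , k≤ , λ {w} → U⊆S {w}))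
    ... | yes (U , cl , k≤ , U⊆S) = inj₂ (U , component U⊆S closed′ , clique cl (≤-antisym ∣U∣≤k k≤))
      where
      U⊆N : ∀ {u} → u ∈ U → U ⊆ N[ S , u ]
      U⊆N {u} u∈U {w} w∈U with w ≟ u
      ... | yes w≡u = ∈N⁺ (U⊆S w∈U , inj₁ w≡u)
      ... | no w≢u = ∈N⁺ (U⊆S w∈U , inj₂ (cl u w u∈U w∈U (w≢u ∘ sym)))
      ∣U∣≤k : ∣ U ∣ ≤ k
      ∣U∣≤k = let u , u∈U = 1≤∣p∣⇒nonempty (≤-trans 1≤k k≤) in
        ≤-trans (p⊆q⇒∣p∣≤∣q∣ (U⊆N u∈U)) (bound (U⊆S u∈U))
      closed′ : Closed U S
      closed′ u w u∈U w∈S w∉U u~w = <⇒≱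
        (p⊂q⇒∣p∣<∣q∣ {p = U} (U⊆N u∈U , w , ∈N⁺ (w∈S , inj₂ u~w) , w∉U))
        (≤-trans (bound (U⊆S u∈U)) k≤)

    -- A vertex with at least k + 2 vertices in its closed neighbourhood is tried first; if there is
    -- none, the bound k + 1 holds everywhere. This takes the place of choosing v of maximum degree.
    connected-outcome : Outcome S
    connected-outcome
      with any? (λ v → (v ∈? S) ×-dec (2 + k ≤? ∣ N[ S , v ] ∣))
         | any? (λ v → (v ∈? S) ×-dec (suc k ≤? ∣ N[ S , v ] ∣))
    ... | yes (v , v∈S , 2+k≤) | _ = At.vertex-outcome v∈S (<⇒≤ 2+k≤) (inj₁ 2+k≤)
    ... | no none | yes (v , v∈S , 1+k≤) = At.vertex-outcome v∈S 1+k≤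
      (inj₂ λ {u} u∈S → ≮⇒≥ λ 2+k≤ → none (u , u∈S , 2+k≤))
    ... | no _ | no none = low-degree-outcome λ {u} u∈S → ≮⇒≥ λ 1+k≤ → none (u , u∈S , 1+k≤)

  -- Recursion over vertex sets and the upper bound

  outcome : ∀ S → Acc _<_ ∣ S ∣ → Outcome S
  outcome S (acc rec) with conn? S
  ... | inj₁ conn = Induction.connected-outcome S conn (λ R R<S → outcome R (rec R<S))
  ... | inj₂ (U , cU , (a , a∈U) , (b , b∈))
    with outcome U (rec (p⊂q⇒∣p∣<∣q∣ {p = U} (⊆-whole cU , b , p─q⊆p S U b∈ , x∈p─q⇒x∉q S U b∈)))
       | outcome (S ─ U) (rec (p∩q≢∅⇒∣p─q∣<∣p∣ S U (a , x∈p∩q⁺ (⊆-whole cU a∈U , a∈U))))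
  ... | inj₂ (H , cH , sp) | _ = inj₂ (H , component-trans cH cU , sp)
  ... | inj₁ _ | inj₂ (H , cH , sp) = inj₂ (H , component-trans cH (component-─ cU component-refl) , sp)
  ... | inj₁ (good D costD clearD) | inj₁ (good E costE clearE) = inj₁ (good (D ++ E) cost clear)
    where
    cost : length (D ++ E) * suc k ≤ ∣ S ∣
    cost = begin
      length (D ++ E) * suc k              ≡⟨ ++-cost D E ⟩
      length D * suc k + length E * suc k  ≤⟨ +-mono-≤ costD costE ⟩
      ∣ U ∣ + ∣ S ─ U ∣                    ≡⟨ q⊆p⇒∣q∣+∣p─q∣≡∣p∣ (⊆-whole cU) ⟩
      ∣ S ∣                                ∎
      where open ≤-Reasoning
    cover : ∀ {u} → u ∈ S → Dominated (D ++ E) u ⊎ u ∈ U ⊎ u ∈ S ─ U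
    cover {u} u∈S with u ∈? U
    ... | yes u∈U = inj₂ (inj₁ u∈U)
    ... | no u∉U = inj₂ (inj₂ (x∈p∧x∉q⇒x∈p─q u∈S u∉U))
    clear : Clear (D ++ E) S
    clear = clear-split cover
      (λ u∈U w∈ → closed cU _ _ u∈U (p─q⊆p S U w∈) (x∈p─q⇒x∉q S U w∈))
      (clear-mono Any.++⁺ˡ clearD) (clear-mono (Any.++⁺ʳ D) clearE)

  connected⇒conn : Connected G → Conn ⊤
  connected⇒conn connected U cU (a , a∈U) {b} _ = follow a∈U (connected a b)
    where
    follow : ∀ {a b} → a ∈ U → Reach G a b → b ∈ U
    follow a∈U here = a∈U
    follow {a} a∈U (step {w = w} a~w reach) with w ∈? U
    ... | yes w∈U = follow w∈U reach
    ... | no w∉U = contradiction a~w (closed cU a w a∈U ∈⊤ w∉U)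

  special⊤⇒iso : Special ⊤ → Iso G (K k) ⊎ (k ≡ 2 × Iso G C5)
  special⊤⇒iso (clique cl ∣⊤∣≡k) = inj₁
    (subst (λ m → Iso G (K m)) (trans (sym (∣⊤∣≡n n)) ∣⊤∣≡k) (↔-id _ , adj≡))
    where
    adj≡ : ∀ u v → adj G u v ≡ adj (K n) u v
    adj≡ u v with u ≟ v
    ... | yes refl = adj-irrefl G u
    ... | no u≢v = cl u v ∈⊤ ∈⊤ u≢v
  special⊤⇒iso (pentagon k≡2 P) = inj₂ (k≡2 , iso , adj≡)
    where
    label : Fin n → Fin 5
    label u = proj₁ (corner-onto P (∈⊤ {x = u}))
    corner-label : ∀ u → corner P (label u) ≡ u
    corner-label u = proj₂ (corner-onto P ∈⊤)
    iso : Fin n ↔ Fin 5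
    iso = mk↔ₛ′ label (corner P) (λ i → corner-injective P (corner-label (corner P i))) corner-label
    adj≡ : ∀ u v → adj G u v ≡ adj C5 (label u) (label v)
    adj≡ u v = trans (sym (cong₂ (adj G) (corner-label u) (corner-label v))) (corner-adj P _ _)

  clear⇒isolating : ∀ {D} → Clear D ⊤ → IsolatingSet G k (fromList D)
  clear⇒isolating {D} clear (f , f-inj , f-adj , f-free) =
    clear U U-clique (injective⇒≤∣p∣ f f-inj (λ i → ∈comprehension⁺ image? (i , refl))) (λ _ → ∈⊤) U-free
    where
    image? : ∀ u → Dec (∃ λ i → f i ≡ u)
    image? u = any? λ i → f i ≟ u
    U : Subset n
    U = comprehension image?
    U-clique : IsClique U
    U-clique u v u∈U v∈U u≢v with ∈comprehension⁻ image? u∈U | ∈comprehension⁻ image? v∈U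
    ... | i , refl | j , refl = f-adj i j λ { refl → u≢v refl }
    U-free : ∀ {u} → u ∈ U → ¬ Dominated D u
    U-free u∈U dom with ∈comprehension⁻ image? u∈U
    ... | i , refl = f-free i (Any⇒∃∈fromList dom)

  -- By connectedness a special component of `⊤` is `⊤` itself, which makes G one of the excluded
  -- graphs.
  upper-bound : Connected G → ¬ Iso G (K k) → (k ≡ 2 → ¬ Iso G C5) →
                Σ (Subset n) λ D → IsolatingSet G k D × ∣ D ∣ * suc k ≤ n
  upper-bound connected ≇K ≇C5 with outcome ⊤ (<-wellFounded _)
  ... | inj₁ (good D cost clear) = fromList D , clear⇒isolating clear ,
    ≤-trans (*-monoˡ-≤ (suc k) (∣fromList∣≤length D)) (subst (length D * suc k ≤_) (∣⊤∣≡n n) cost)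
  ... | inj₂ (H , cH , sp)
    with ⊆-antisym (⊆⊤ {p = H}) (connected⇒conn connected H cH (special⇒nonempty sp))
  ... | refl with special⊤⇒iso sp
  ...   | inj₁ iso = contradiction iso ≇K
  ...   | inj₂ (k≡2 , iso) = contradiction iso (≇C5 k≡2)

-- The extremal graphs

module _ {n : ℕ} {f : Fin n → Fin n → Bool} where

  symClose⁺ : ∀ {u v} → u ≢ v → f u v ≡ true → symClose f u v ≡ true
  symClose⁺ {u} {v} u≢v fuv with u ≟ v
  ... | yes u≡v = contradiction u≡v u≢v
  ... | no _ rewrite fuv = refl

  symClose⁻ : ∀ {u v} → symClose f u v ≡ true → f u v ≡ true ⊎ f v u ≡ true
  symClose⁻ {u} {v} eq with u ≟ v | eq
  ... | yes _ | ()
  ... | no _ | eq′ with f u v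
  ...   | true = inj₁ refl
  ...   | false = inj₂ eq′

-- Serves to tell `B 5 2`, which contains a triangle, from `C5`.
C5-triangle-free : ∀ i j l → adj C5 i j ≡ true → adj C5 j l ≡ true → ¬ adj C5 i l ≡ true
C5-triangle-free = from-yes (all? λ i → all? λ j → all? λ l →
  (adj C5 i j ≟ᵇ true) →-dec (adj C5 j l ≟ᵇ true) →-dec ¬? (adj C5 i l ≟ᵇ true))

module _ {n : ℕ} {G : Graph n} where

  reach-trans : ∀ {u v w} → Reach G u v → Reach G v w → Reach G u w
  reach-trans here r = r
  reach-trans (step e q) r = step e (reach-trans q r)

  reach-sym : ∀ {u v} → Reach G u v → Reach G v u
  reach-sym here = here
  reach-sym (step {u} {w} e r) = reach-trans (reach-sym r) (step (trans (adj-sym G w u) e) here)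

<⇒<ᵇ≡true : ∀ {x y} → x < y → (x <ᵇ y) ≡ true
<⇒<ᵇ≡true x<y = dec-true (_ <? _) x<y

≤⇒<ᵇ≡false : ∀ {x y} → y ≤ x → (x <ᵇ y) ≡ false
≤⇒<ᵇ≡false y≤x = dec-false (_ <? _) (≤⇒≯ y≤x)

≡⇒≡ᵇ≡true : ∀ {x y} → x ≡ y → (x ≡ᵇ y) ≡ true
≡⇒≡ᵇ≡true x≡y = dec-true (_ ℕ.≟ _) x≡y

≡ᵇ≡true⇒≡ : ∀ {x y} → (x ≡ᵇ y) ≡ true → x ≡ y
≡ᵇ≡true⇒≡ {x} {y} eq = ≡ᵇ⇒≡ x y (subst T (sym eq) _)

module Extremal (n k′ : ℕ) (3≤n : 3 ≤ n) where

  k a b : ℕ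
  k = suc k′
  a = n / suc k
  b = n ∸ k * a

  a+ka≤n : a + k * a ≤ n
  a+ka≤n = subst (_≤ n) (*-comm a (suc k)) (m/n*n≤m n (suc k))

  b+ka≡n : b + k * a ≡ n
  b+ka≡n = m∸n+n≡m (m+n≤o⇒n≤o a a+ka≤n)

  a≤b : a ≤ b
  a≤b = m+n≤o⇒m≤o∸n a a+ka≤n

  b≤n : b ≤ n
  b≤n = m∸n≤m n (k * a)

  1≤b : 1 ≤ b
  1≤b with a in eq | a≤b
  ... | suc _ | 1+_≤b = ≤-trans (s≤s z≤n) 1+_≤b
  -- For a = 0 the path takes up all n vertices, and n is at least 3.
  ... | zero | _ = subst (λ m → 1 ≤ n ∸ m) (sym (*-zeroʳ k)) (≤-trans (s≤s z≤n) 3≤n)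

  rel : Fin n → Fin n → Bool
  rel = B-rel n k

  clique-of : Fin n → ℕ
  clique-of u = (toℕ u ∸ b) / k

  -- Path vertex j together with the clique F_j forms block j (counting from 0); for j ≥ a it is just j.
  block : Fin n → ℕ
  block u = if toℕ u <ᵇ b then toℕ u else clique-of u

  rel-path : ∀ {u v} → toℕ u < b → toℕ v < b → rel u v ≡ pathAdjℕ (toℕ u) (toℕ v)
  rel-path u<b v<b rewrite <⇒<ᵇ≡true u<b | <⇒<ᵇ≡true v<b = refl

  rel-block : ∀ {u v} → b ≤ toℕ v → rel u v ≡ (block u ≡ᵇ clique-of v)
  rel-block {u} {v} b≤v rewrite ≤⇒<ᵇ≡false b≤v with toℕ u <ᵇ b
  ... | true = refl
  ... | false = refl

  rel-block′ : ∀ {u v} → b ≤ toℕ v → rel v u ≡ true → block u ≡ clique-of v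
  rel-block′ {u} {v} b≤v rewrite ≤⇒<ᵇ≡false b≤v with toℕ u <ᵇ b
  ... | true = ≡ᵇ≡true⇒≡
  ... | false = sym ∘ ≡ᵇ≡true⇒≡

  block-clique : ∀ {v} → b ≤ toℕ v → block v ≡ clique-of v
  block-clique b≤v rewrite ≤⇒<ᵇ≡false b≤v = refl

  block-path : ∀ {v} → toℕ v < b → block v ≡ toℕ v
  block-path v<b rewrite <⇒<ᵇ≡true v<b = refl

  -- All edges at a clique vertex stay inside its block, so only vertices of block j can dominate a
  -- member of F_j.
  adj⇒block : ∀ {u v} → b ≤ toℕ v → adj (B n k) u v ≡ true → block u ≡ clique-of v
  adj⇒block {u} {v} b≤v u~v with symClose⁻ {f = rel} {u} {v} u~v
  ... | inj₁ r = ≡ᵇ≡true⇒≡ (trans (sym (rel-block {u} {v} b≤v)) r)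
  ... | inj₂ r = rel-block′ b≤v r

  block⇒adj : ∀ {u v} → u ≢ v → b ≤ toℕ v → block u ≡ clique-of v → adj (B n k) u v ≡ true
  block⇒adj {u} {v} u≢v b≤v eq = symClose⁺ {f = rel} u≢v (trans (rel-block {u} {v} b≤v) (≡⇒≡ᵇ≡true eq))

  clique-of<a : ∀ {v} → b ≤ toℕ v → clique-of v < a
  clique-of<a {v} b≤v = m<n*o⇒m/o<n {toℕ v ∸ b} {a} {k} (subst (toℕ v ∸ b <_) (*-comm k a)
    (m<n+o⇒m∸n<o (toℕ v) b {{>-nonZero ka-pos}}
      (subst (toℕ v <_) (sym b+ka≡n) (toℕ<n v))))
    where
    ka-pos : 0 < k * a
    ka-pos = +-cancelˡ-< b 0 (k * a)
      (subst₂ _<_ (sym (+-identityʳ b)) (sym b+ka≡n) (≤-<-trans b≤v (toℕ<n v)))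

  origin : Fin n
  origin = fromℕ< (≤-trans 1≤b b≤n)

  reach-path : ∀ m u → toℕ u ≡ m → m < b → Reach (B n k) u origin
  reach-path zero u eq _ = subst (Reach (B n k) u) (toℕ-injective (trans eq (sym (toℕ-fromℕ< _)))) here
  reach-path (suc m) u eq m<b = step u~w (reach-path m w (toℕ-fromℕ< _) (<⇒≤ m<b))
    where
    w : Fin n
    w = fromℕ< (≤-trans (<⇒≤ m<b) b≤n)
    w≡m : toℕ w ≡ m
    w≡m = toℕ-fromℕ< _
    w~u : adj (B n k) w u ≡ true
    w~u = symClose⁺ {f = rel} (λ w≡u → 1+n≢n (trans (sym eq) (trans (cong toℕ (sym w≡u)) w≡m)))
      (trans (rel-path {w} {u} (subst (_< b) (sym w≡m) (<⇒≤ m<b)) (subst (_< b) (sym eq) m<b))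
             (≡⇒≡ᵇ≡true (trans eq (cong suc (sym w≡m)))))
    u~w : adj (B n k) u w ≡ true
    u~w = trans (adj-sym (B n k) u w) w~u

  -- A clique vertex first steps to the path vertex of its own block, which exists because clique
  -- indices are below a and `a≤b`.
  reach-origin : ∀ u → Reach (B n k) u origin
  reach-origin u with toℕ u <? b
  ... | yes u<b = reach-path _ u refl u<b
  ... | no u≮b = step (trans (adj-sym (B n k) u w) w~u) (reach-path _ w w≡ c<b)
    where
    b≤u : b ≤ toℕ u
    b≤u = ≮⇒≥ u≮b
    c<b : clique-of u < b
    c<b = ≤-trans (clique-of<a b≤u) a≤b
    w : Fin n
    w = fromℕ< (≤-trans c<b b≤n)
    w≡ : toℕ w ≡ clique-of u
    w≡ = toℕ-fromℕ< _
    w<b : toℕ w < b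
    w<b = subst (_< b) (sym w≡) c<b
    w~u : adj (B n k) w u ≡ true
    w~u = block⇒adj (λ w≡u → u≮b (subst (λ x → toℕ x < b) w≡u w<b)) b≤u (trans (block-path w<b) w≡)

  B-connected : Connected (B n k)
  B-connected u v = reach-trans (reach-origin u) (reach-sym (reach-origin v))

  member< : ∀ {j i} → j < a → i < k → b + (j * k + i) < n
  member< {j} {i} j<a i<k = begin-strict
    b + (j * k + i)  <⟨ +-monoʳ-< b (+-monoʳ-< (j * k) i<k) ⟩
    b + (j * k + k)  ≡⟨ cong (b +_) (+-comm (j * k) k) ⟩
    b + suc j * k    ≤⟨ +-monoʳ-≤ b (*-monoˡ-≤ k j<a) ⟩
    b + a * k        ≡⟨ cong (b +_) (*-comm a k) ⟩
    b + k * a        ≡⟨ b+ka≡n ⟩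
    n                ∎
    where open ≤-Reasoning

  module _ (j : Fin a) where

    member : Fin k → Fin n
    member i = fromℕ< (member< (toℕ<n j) (toℕ<n i))

    toℕ-member : ∀ i → toℕ (member i) ≡ b + (toℕ j * k + toℕ i)
    toℕ-member i = toℕ-fromℕ< _

    b≤member : ∀ i → b ≤ toℕ (member i)
    b≤member i = ≤-trans (m≤m+n b _) (≤-reflexive (sym (toℕ-member i)))

    clique-of-member : ∀ i → clique-of (member i) ≡ toℕ j
    clique-of-member i = begin
      (toℕ (member i) ∸ b) / k             ≡⟨ cong (λ m → (m ∸ b) / k) (toℕ-member i) ⟩
      (b + (toℕ j * k + toℕ i) ∸ b) / k    ≡⟨ cong (_/ k) (m+n∸m≡n b _) ⟩
      (toℕ j * k + toℕ i) / k              ≡⟨ +-distrib-/-∣ˡ (toℕ i) (divides (toℕ j) refl) ⟩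
      toℕ j * k / k + toℕ i / k            ≡⟨ cong₂ _+_ (m*n/n≡m (toℕ j) k) (m<n⇒m/n≡0 (toℕ<n i)) ⟩
      toℕ j + 0                            ≡⟨ +-identityʳ (toℕ j) ⟩
      toℕ j                                ∎
      where open ≡-Reasoning

    member-injective : Injective _≡_ _≡_ member
    member-injective {i} {i′} eq = toℕ-injective (+-cancelˡ-≡ (toℕ j * k) _ _ (+-cancelˡ-≡ b _ _
      (trans (sym (toℕ-member i)) (trans (cong toℕ eq) (toℕ-member i′)))))

  -- If D missed block j, the clique F_j would avoid the closed neighbourhood of D. Picking a vertex
  -- of D in each block below a is injective, since `block` recovers j.
  lower-bound : ∀ D → IsolatingSet (B n k) k D → a ≤ ∣ D ∣
  lower-bound D isolating = injective⇒≤∣p∣ (proj₁ ∘ hit)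
    (λ {i} {j} eq → toℕ-injective
      (trans (sym (proj₂ (proj₂ (hit i)))) (trans (cong block eq) (proj₂ (proj₂ (hit j))))))
    (proj₁ ∘ proj₂ ∘ hit)
    where
    hit : ∀ j → ∃ λ u → u ∈ D × block u ≡ toℕ j
    hit j with any? (λ u → (u ∈? D) ×-dec (block u ℕ.≟ toℕ j))
    ... | yes found = found
    ... | no none = contradiction (member j , (λ {i} {i′} → member-injective j {i} {i′}) , pairwise , free)
      isolating
      where
      pairwise : ∀ i i′ → i ≢ i′ → adj (B n k) (member j i) (member j i′) ≡ true
      pairwise i i′ i≢i′ = block⇒adj (i≢i′ ∘ member-injective j) (b≤member j i′)
        (trans (block-clique (b≤member j i)) (trans (clique-of-member j i) (sym (clique-of-member j i′))))
      free : ∀ i → ¬ InClosedNbhd (B n k) D (member j i)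
      free i (u , u∈D , inj₁ refl) =
        none (u , u∈D , trans (block-clique (b≤member j i)) (clique-of-member j i))
      free i (u , u∈D , inj₂ u~) =
        none (u , u∈D , trans (adj⇒block (b≤member j i) u~) (clique-of-member j i))

  -- An isomorphism forces n = k, hence a = 0, and the graph is a path on at least 3 vertices. There
  -- labels 0 and 2 are not adjacent, while in `K k` all distinct vertices are.
  B≇K : ¬ Iso (B n k) (K k)
  B≇K (φ , φ-adj) = [ no-edge ≡0 ≡2 v₀<b v₂<b (λ ()) , no-edge ≡2 ≡0 v₂<b v₀<b (λ ()) ]′
    (symClose⁻ {f = rel} {v₀} {v₂} (trans (φ-adj v₀ v₂)
      (symClose⁺ {f = λ _ _ → true} (v₀≢v₂ ∘ Injection.injective (↔⇒↣ φ)) refl)))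
    where
    v₀ v₂ : Fin n
    v₀ = fromℕ< (≤-trans (s≤s z≤n) 3≤n)
    v₂ = fromℕ< 3≤n
    ≡0 : toℕ v₀ ≡ 0
    ≡0 = toℕ-fromℕ< _
    ≡2 : toℕ v₂ ≡ 2
    ≡2 = toℕ-fromℕ< _
    v₀≢v₂ : v₀ ≢ v₂
    v₀≢v₂ eq with trans (sym ≡0) (trans (cong toℕ eq) ≡2)
    ... | ()
    b≡n : b ≡ n
    b≡n = trans (cong (λ m → n ∸ k * m) (m<n⇒m/n≡0 (s≤s (≤-reflexive (↔⇒≡ φ)))))
                (cong (n ∸_) (*-zeroʳ k))
    v₀<b : toℕ v₀ < b
    v₀<b = subst (toℕ v₀ <_) (sym b≡n) (toℕ<n v₀)
    v₂<b : toℕ v₂ < b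
    v₂<b = subst (toℕ v₂ <_) (sym b≡n) (toℕ<n v₂)
    no-edge : ∀ {u v x y} → toℕ u ≡ x → toℕ v ≡ y → toℕ u < b → toℕ v < b → y ≢ suc x → ¬ rel u v ≡ true
    no-edge {u} {v} refl refl u<b v<b v≢1+u r =
      v≢1+u (≡ᵇ≡true⇒≡ (trans (sym (rel-path {u} {v} u<b v<b)) r))

-- Here a = 1 and b = 3: labels 3 and 4 form the only clique, joined to label 0, so 0, 3 and 4 span
-- a triangle.
B₅₂≇C5 : ¬ Iso (B 5 2) C5
B₅₂≇C5 (φ , φ-adj) = C5-triangle-free (Inverse.to φ 0F) (Inverse.to φ 3F) (Inverse.to φ 4F)
  (sym (φ-adj 0F 3F)) (sym (φ-adj 3F 4F)) (sym (φ-adj 0F 4F))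

theorem1p1 : ((k n : ℕ) → 1 ≤ k → (G : Graph n) → Connected G → ¬ Iso G (K k) → (k ≡ 2 → ¬ Iso G C5) →
    Σ (Subset n) λ D → IsolatingSet G k D × ∣ D ∣ * suc k ≤ n)
    × ((k n : ℕ) → 1 ≤ k → 3 ≤ n →
    IsIotaMax n k (n / suc k) × IsIota (B n k) k (n / suc k))
theorem1p1 = bound , extremal
  where
  bound : (k n : ℕ) → 1 ≤ k → (G : Graph n) → Connected G → ¬ Iso G (K k) → (k ≡ 2 → ¬ Iso G C5) →
    Σ (Subset n) λ D → IsolatingSet G k D × ∣ D ∣ * suc k ≤ n
  bound k n 1≤k G = Isolation.upper-bound G k 1≤k

  extremal : (k n : ℕ) → 1 ≤ k → 3 ≤ n →
    IsIotaMax n k (n / suc k) × IsIota (B n k) k (n / suc k)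
  extremal k@(suc k′) n 1≤k 3≤n = ((B n k , admissible , iota) , maximal) , iota
    where
    open Extremal n k′ 3≤n using (B-connected; B≇K; lower-bound)

    B≇C5 : k ≡ 2 → ¬ Iso (B n k) C5
    B≇C5 refl iso with ↔⇒≡ (proj₁ iso)
    ... | refl = B₅₂≇C5 iso

    admissible : Admissible k (B n k)
    admissible = B-connected , B≇K , B≇C5

    quotient-bound : ∀ {m} → m * suc k ≤ n → m ≤ n / suc k
    quotient-bound {m} m*≤n = subst (_≤ n / suc k) (m*n/n≡m m (suc k)) (/-monoˡ-≤ (suc k) m*≤n)

    maximal : (G : Graph n) → Admissible k G → ∀ m′ → IsIota G k m′ → m′ ≤ n / suc k
    maximal G (connected , ≇K , ≇C5) m′ (_ , minimal) =
      let D , isolating , cost = bound k n 1≤k G connected ≇K ≇C5 in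
      ≤-trans (minimal D isolating) (quotient-bound cost)

    -- The upper bound, applied to `B n k` itself, supplies the isolating set; `lower-bound` shows
    -- that its size is exactly the quotient and that no smaller set will do.
    iota : IsIota (B n k) k (n / suc k)
    iota = let D , isolating , cost = bound k n 1≤k (B n k) B-connected B≇K B≇C5 in
      (D , isolating , ≤-antisym (quotient-bound cost) (lower-bound D isolating)) , lower-bound
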